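{- For every integer $n\ge 1$, the map $\Phi:\mathrm{VHC}(S_{n-1})\to\widetilde{\mathcal P}^c(n)$ (defined in the context) is a bijection.
   Context: Valid hook configurations. $S_n$ is the set of permutations of $\{1,\ldots,n\}$, written $\pi=\pi_1\cdots\pi_n$ ($S_0$ consists of the empty permutation). A descent of $\pi$ is an index $i\in\{1,\ldots,n-1\}$ with $\pi_i>\pi_{i+1}$. The plot of $\pi$ is the set of points $(i,\pi_i)$. A hook of $\pi$ is given by a southwest endpoint $(i,\pi_i)$ and a northeast endpoint $(j,\pi_j)$ with $i<j$ and $\pi_i<\pi_j$; it is the L-shaped set $(\{i\}\times[\pi_i,\pi_j])\cup([i,j]\times\{\pi_j\})$. If $\pi$ has descents $d_1<\cdots<d_k$, a valid hook configuration of $\pi$ is a tuple $\mathcal H=(H_1,\ldots,H_k)$ of hooks of $\pi$ such that: (1) for each $i$, the southwest endpoint of $H_i$ is $(d_i,\pi_{d_i})$; (2) no point of the plot lies directly above a hook (i.e., if a hook has endpoints $(i,\pi_i)$ and $(j,\pi_j)$ and $i<l<j$, then $\pi_l<\pi_j$); (3) hooks do not intersect each other, except that the northeast endpoint of one hook may be the southwest endpoint of another. $\mathrm{VHC}(\pi)$ is the set of valid hook configurations of $\pi$, and $\mathrm{VHC}(S_{n-1})=\bigcup_{\pi\in S_{n-1}}\mathrm{VHC}(\pi)$ (a disjoint union; a configuration carries its underlying permutation). Set partitions. For a partition $\rho$ of $\{1,\ldots,n\}$, two distinct blocks $B,B'$ form a crossing if there are $i,k\in B$ and $j,\ell\in B'$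 with $i<j<k<\ell$ or $i>j>k>\ell$. The crossing graph $G(\rho)$ has the blocks of $\rho$ as vertices, two blocks being adjacent iff they form a crossing. $\widetilde{\mathcal P}^c(n)$ is the set of pairs $(\rho,\alpha)$ where $\rho$ is a partition of $\{1,\ldots,n\}$ with $G(\rho)$ connected and $\alpha$ is an acyclic orientation of $G(\rho)$ whose only source (vertex of in-degree $0$) is the block containing $n$. The map $\Phi$. Let $\mathcal H\in\mathrm{VHC}(\pi)$ with $\pi\in S_{n-1}$. Draw a blue "sky" above the plot and give the hooks distinct colors other than blue. A point $(l,\pi_l)$ that is not a northeast endpoint of a hook looks directly upward and gets the color of the first hook it sees, or blue if it sees no hook; a southwest endpoint of a hook looks around (on the left side of) the vertical part of that hook, so it does not see its own hook. (That is: among hooks with endpoints $(d,\pi_d)$, $(j,\pi_j)$ satisfying $d<l<j$, take the one with smallest $\pi_j$; the color is that hook's color, or blue if there is no such hook.) The northeast endpoint of a hook gets the color of that hook. Color $\pi_i$ like the point $(i,\pi_i)$, and color $n$ blue; this gives a partition $\rho$ of $\{1,\ldots,n\}$ into color classes. For a block $B$ let $\widehat B=\{i:1\le i\le n-1,\ \pi_i\in B\}$. Orient each edge of $G(\rho)$ between $B$ and $B'$ from $B$ to $B'$ if $\min\widehat B<\min\widehat{B'}$ and from $B'$ to $B$ otherwise; call this orientation $\alpha$. Then $\Phi(\mathcal H)=(\rho,\alpha)$. -}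

module Defs where

open import Data.Fin using (Fin; toℕ; fromℕ; inject₁; _<_; _>_; _≤_)
open import Data.Fin.Permutation
  using (Permutation′; _⟨$⟩ʳ_; _⟨$⟩ˡ_) renaming (_≈_ to _≈ₚ_)
open import Data.Fin.Properties using (_≟_; _<?_; any?)
open import Data.Fin.Relation.Unary.Top using (view; ‵fromℕ; ‵inject₁)
open import Data.Fin.Subset using (Subset; Nonempty; _∈_)
open import Data.List using (List; map; filter; allFin)
open import Data.List.Extrema.Nat using (argmin)
import Data.List.Membership.Propositional as List
import Data.List.Relation.Unary.Any as Any
open import Data.Nat using (ℕ; suc)
import Data.Nat.Properties as ℕ
open import Data.Product using (_×_; _,_; ∃; ∃-syntax; proj₁; proj₂)
open import Data.Sum using (_⊎_)
open import Function using (_⇔_)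
open import Level using (0ℓ)
open import Relation.Binary using (Rel)
open import Relation.Binary.Construct.Closure.ReflexiveTransitive using (Star)
open import Relation.Binary.Construct.Closure.Transitive using (TransClosure)
open import Relation.Binary.PropositionalEquality using (_≡_; _≢_)
open import Relation.Nullary using (¬_; Dec; yes; no)
open import Relation.Nullary.Decidable using (_×-dec_)
open import Relation.Unary using (Pred)

-- Throughout, n = suc m, so that S_{n-1} is Permutation′ m.  Indices and values
-- are 0-based: {1,…,n-1} is Fin m, {1,…,n} is Fin (suc m), the value π_i is
-- inject₁ (π ⟨$⟩ʳ i) in the latter, and n itself is fromℕ m.

------------------------------------------------------------------------
-- Valid hook configurations

Descent : ∀ {m} → Permutation′ m → Pred (Fin m) 0ℓ
Descent π i = ∃[ j ] toℕ j ≡ suc (toℕ i) × π ⟨$⟩ʳ i > π ⟨$⟩ʳ j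

descent? : ∀ {m} (π : Permutation′ m) i → Dec (Descent π i)
descent? π i =
  any? λ j → (toℕ j ℕ.≟ suc (toℕ i)) ×-dec (π ⟨$⟩ʳ j <? π ⟨$⟩ʳ i)

descents : ∀ {m} → Permutation′ m → List (Fin m)
descents {m} π = filter (descent? π) (allFin m)

-- A hook is given by the indices i, j of its endpoints (i , π_i) and (j , π_j).
record Hook (m : ℕ) : Set where
  constructor hook
  field
    sw ne : Fin m

open Hook public

IsHook : ∀ {m} → Permutation′ m → Pred (Hook m) 0ℓ
IsHook π H = sw H < ne H × π ⟨$⟩ʳ sw H < π ⟨$⟩ʳ ne H

-- The lattice points (x , y) of the L-shaped set.  Hooks consist of vertical and
-- horizontal segments with integer endpoints, so two hooks meet in a point that
-- is not a lattice point only if they overlap along a segment between lattice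
-- points; lattice points therefore suffice to express non-intersection.
OnHook : ∀ {m} → Permutation′ m → Hook m → Fin m → Fin m → Set
OnHook π H x y =
    (x ≡ sw H × π ⟨$⟩ʳ sw H ≤ y × y ≤ π ⟨$⟩ʳ ne H)
  ⊎ (sw H ≤ x × x ≤ ne H × y ≡ π ⟨$⟩ʳ ne H)

AtSW AtNE : ∀ {m} → Permutation′ m → Hook m → Fin m → Fin m → Set
AtSW π H x y = x ≡ sw H × y ≡ π ⟨$⟩ʳ sw H
AtNE π H x y = x ≡ ne H × y ≡ π ⟨$⟩ʳ ne H

record IsVHC {m} (π : Permutation′ m) (hooks : List (Hook m)) : Set where
  field
    isHook          : ∀ {H} → H List.∈ hooks → IsHook π H
    southwest       : map sw hooks ≡ descents π
    noPointAbove    : ∀ {H} → H List.∈ hooks →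
                      ∀ l → sw H < l → l < ne H → π ⟨$⟩ʳ l < π ⟨$⟩ʳ ne H
    nonIntersecting : ∀ {H H′} → H List.∈ hooks → H′ List.∈ hooks → H ≢ H′ →
                      ∀ x y → OnHook π H x y → OnHook π H′ x y →
                      (AtNE π H x y × AtSW π H′ x y) ⊎
                      (AtSW π H x y × AtNE π H′ x y)

-- VHC m is VHC(S_m).
record VHC (m : ℕ) : Set where
  field
    perm  : Permutation′ m
    hooks : List (Hook m)
    isVHC : IsVHC perm hooks

infix 4 _≈ᵛ_

_≈ᵛ_ : ∀ {m} → Rel (VHC m) 0ℓ
H ≈ᵛ H′ = VHC.perm H ≈ₚ VHC.perm H′ × VHC.hooks H ≡ VHC.hooks H′

------------------------------------------------------------------------
-- Set partitions and acyclic orientations of their crossing graphs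

-- A family ρ of subsets of {1,…,n} is a predicate on Subset n; B is a block of ρ
-- when ρ B holds.
record IsPartition {n} (ρ : Pred (Subset n) 0ℓ) : Set where
  field
    nonempty : ∀ {B} → ρ B → Nonempty B
    cover    : ∀ i → ∃[ B ] ρ B × i ∈ B
    disjoint : ∀ {B B′ i} → ρ B → ρ B′ → i ∈ B → i ∈ B′ → B ≡ B′

Crossing : ∀ {n} → Rel (Subset n) 0ℓ
Crossing B B′ = B ≢ B′ ×
  ∃[ i ] ∃[ j ] ∃[ k ] ∃[ l ] i ∈ B × k ∈ B × j ∈ B′ × l ∈ B′ ×
    ((i < j × j < k × k < l) ⊎ (i > j × j > k × k > l))

CrossingGraph : ∀ {n} → Pred (Subset n) 0ℓ → Rel (Subset n) 0ℓ
CrossingGraph ρ B B′ = ρ B × ρ B′ × Crossing B B′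

Connected : ∀ {n} → Pred (Subset n) 0ℓ → Set
Connected ρ = ∀ {B B′} → ρ B → ρ B′ → Star (CrossingGraph ρ) B B′

-- An orientation is the relation α whose pairs (B , B′) are the edges directed
-- from B to B′.
record IsOrientation {n} (ρ : Pred (Subset n) 0ℓ) (α : Rel (Subset n) 0ℓ) : Set where
  field
    edge    : ∀ {B B′} → α B B′ → CrossingGraph ρ B B′
    orient  : ∀ {B B′} → CrossingGraph ρ B B′ → α B B′ ⊎ α B′ B
    oneWay  : ∀ {B B′} → α B B′ → ¬ α B′ B

Acyclic : ∀ {n} → Rel (Subset n) 0ℓ → Set
Acyclic α = ∀ {B} → ¬ TransClosure α B B

Source : ∀ {n} → Pred (Subset n) 0ℓ → Rel (Subset n) 0ℓ → Pred (Subset n) 0ℓ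
Source ρ α B = ρ B × (∀ B′ → ¬ α B′ B)

OrientedFamily : ℕ → Set₁
OrientedFamily n = Pred (Subset n) 0ℓ × Rel (Subset n) 0ℓ

record IsAcyclicConnected {m} (ρα : OrientedFamily (suc m)) : Set where
  private
    ρ = proj₁ ρα
    α = proj₂ ρα
  field
    isPartition   : IsPartition ρ
    connected     : Connected ρ
    isOrientation : IsOrientation ρ α
    acyclic       : Acyclic α
    onlySource    : ∀ {B} → ρ B → Source ρ α B ⇔ fromℕ m ∈ B

-- 𝒫ᶜ m is P̃ᶜ(n) for n = suc m.
𝒫ᶜ : ℕ → Set₁
𝒫ᶜ m = ∃ λ (ρα : OrientedFamily (suc m)) → IsAcyclicConnected ρα

infix 4 _≈ᵖ_

_≈ᵖ_ : ∀ {m} → Rel (𝒫ᶜ m) 0ℓ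
((ρ , α) , _) ≈ᵖ ((ρ′ , α′) , _) =
  (∀ B → ρ B ⇔ ρ′ B) × (∀ B B′ → α B B′ ⇔ α′ B B′)

------------------------------------------------------------------------
-- The map Φ

data Colour (m : ℕ) : Set where
  blue   : Colour m
  ofHook : Hook m → Colour m

Least : ∀ {m} → Pred (Fin m) 0ℓ → Pred (Fin m) 0ℓ
Least P i = P i × (∀ {j} → P j → i ≤ j)

module _ {m} (H : VHC m) where
  open VHC H renaming (perm to π)

  -- The sky lies above every point of the plot.
  height : Colour m → ℕ
  height blue       = m
  height (ofHook h) = toℕ (π ⟨$⟩ʳ ne h)

  lookUp : Fin m → Colour m
  lookUp l = argmin height blue
    (map ofHook (filter (λ h → (sw h <? l) ×-dec (l <? ne h)) hooks))

  pointColour : Fin m → Colour m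
  pointColour l with Any.any? (λ h → ne h ≟ l) hooks
  ... | yes l∈ne = ofHook (Any.lookup l∈ne)
  ... | no  _    = lookUp l

  colour : Fin (suc m) → Colour m
  colour v with view v
  ... | ‵fromℕ     = blue
  ... | ‵inject₁ w = pointColour (π ⟨$⟩ˡ w)

  ColourClass : Pred (Subset (suc m)) 0ℓ
  ColourClass B = ∃[ v ] (∀ u → u ∈ B ⇔ colour u ≡ colour v)

  Hat : Subset (suc m) → Pred (Fin m) 0ℓ
  Hat B i = inject₁ (π ⟨$⟩ʳ i) ∈ B

  -- Blocks joined by an edge are disjoint and have at least two elements each,
  -- so their hats are nonempty with distinct minima, and exactly one of
  -- MinOrder B B′ and MinOrder B′ B holds.
  MinOrder : Rel (Subset (suc m)) 0ℓ
  MinOrder B B′ = CrossingGraph ColourClass B B′ ×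
    ∃[ i ] ∃[ j ] Least (Hat B) i × Least (Hat B′) j × i < j

  Φ : OrientedFamily (suc m)
  Φ = ColourClass , MinOrder

-- Inserting a sky hook, a valid hook configuration becomes a word w in the values 1,…,n together
-- with a laminar family of intervals of positions, one for each block of ρ: the hook with endpoints
-- at positions d < j gives [d+1, j].  A block is named by its maximum, the value at the end of its
-- interval.  Along a block the values increase, and from any position one climbs to a larger value
-- by going to the next position or, at a descent, to the end of the hook (climb, path).
--
-- The word is recovered from (ρ , α) by a greedy rule.  After a value x, the candidates are the
-- unplaced values of the blocks already opened and the maxima of the unopened blocks C with
-- min C < x < max C all of whose in-neighbours are opened; if z is the least candidate, the next
-- value is the least unplaced value of the block of z.  A configuration obeys the rule because a
-- block opened later than its first opportunity crosses a block opened in the meantime (crossed);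
-- this proves injectivity, and the same crossing argument provides the in-neighbour of every block
-- other than the root.  Conversely, the rule runs until n is placed, which happens only when every
-- value has been placed (trapped), and its word carries a laminar family of intervals.

module Submission where

open import Data.Bool using (true)
open import Data.Fin as Fin using (Fin; zero; suc; toℕ; fromℕ; fromℕ<; inject₁; lower₁)
open import Data.Fin.Induction using (spo-wellFounded)
open import Data.Fin.Permutation using (Permutation′; permutation; _⟨$⟩ʳ_; _⟨$⟩ˡ_; inverseˡ; inverseʳ)
open import Data.Fin.Properties as Fin using (_≟_; any?; all?)
open import Data.Fin.Relation.Unary.Top using (view; ‵fromℕ; ‵inject₁)
open import Data.Fin.Subset using (Subset; _∈_)
open import Data.Fin.Subset.Properties using (_∈?_; ⊆-antisym)
open import Data.List using (List; []; _∷_; map; filter; allFin)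
open import Data.List.Extrema.Nat using (argmin-sel; f[argmin]≤f[xs])
import Data.List.Membership.Propositional as List
open import Data.List.Membership.Propositional.Properties
  using (∈-map⁺; ∈-map⁻; ∈-filter⁺; ∈-filter⁻; ∈-allFin)
open import Data.List.Properties using (filter-≐; map-∘; map-id; ∷-injectiveˡ; ∷-injectiveʳ)
import Data.List.Relation.Unary.All as All
open import Data.List.Relation.Unary.Any as Any using (Any; here; there)
import Data.List.Relation.Unary.Any.Properties as Any
open import Data.Nat using (ℕ; zero; suc; z≤n; s≤s; s≤s⁻¹; _≤_; _<_; _≤?_; _<?_; _∸_)
open import Data.Nat.Induction using (<-wellFounded)
import Data.Nat.Properties as ℕ
open import Data.Product using (Σ-syntax; _×_; _,_; ∃; ∃-syntax; proj₁; proj₂)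
open import Data.Sum as Sum using (_⊎_; inj₁; inj₂; [_,_]′; swap)
import Data.Vec as Vec
import Data.Vec.Properties as Vec
open import Function using (_⇔_; mk⇔; Equivalence; _∘_; id)
open import Function.Structures using (IsBijection)
open import Induction.WellFounded using (WellFounded; Acc; acc; wf⇒asym; wf⇒irrefl)
open import Level using (0ℓ)
open import Relation.Binary using (Rel; tri<; tri≈; tri>)
open import Relation.Binary.Construct.Closure.ReflexiveTransitive as Star using (Star; ε; _◅_; _◅◅_)
open import Relation.Binary.Construct.Closure.Transitive as Plus using (TransClosure; [_]; _∷_)
open import Relation.Binary.PropositionalEquality hiding ([_])
open import Relation.Nullary using (¬_; Dec; yes; no; does; contradiction)
open import Relation.Nullary.Decidable as Dec
  using (_×-dec_; _⊎-dec_; _→-dec_; ¬?; dec-true; map′; toSum)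
open import Relation.Unary using (Pred; Decidable)
open import Defs

open Equivalence using (to; from)

-- Partitions and orientations named by block maxima

Value : ℕ → Set
Value m = Fin (suc m)

least? : ∀ {n} {P : Pred (Fin n) 0ℓ} → Decidable P → ∃ (Least P) ⊎ (∀ i → ¬ P i)
least? {zero} P? = inj₂ λ ()
least? {suc n} P? with P? zero
... | yes p = inj₁ (zero , p , λ _ → z≤n)
... | no ¬p with least? (P? ∘ suc)
...   | inj₁ (i , p , least) =
        inj₁ (suc i , p , λ { {zero} q → contradiction q ¬p ; {suc j} q → s≤s (least q) })
...   | inj₂ none = inj₂ λ { zero → ¬p ; (suc i) → none i }

least : ∀ {n} {P : Pred (Fin n) 0ℓ} → Decidable P → ∃ P → ∃ (Least P)
least P? (i , p) with least? P?
... | inj₁ l = l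
... | inj₂ none = contradiction p (none i)

Least-unique : ∀ {n} {P Q : Pred (Fin n) 0ℓ} → (∀ {i} → P i → Q i) → (∀ {i} → Q i → P i) →
               ∀ {i j} → Least P i → Least Q j → i ≡ j
Least-unique P⇒Q Q⇒P (p , i≤) (q , j≤) = Fin.≤-antisym (i≤ (Q⇒P q)) (j≤ (P⇒Q p))

Greatest : ∀ {n} → Pred (Fin n) 0ℓ → Pred (Fin n) 0ℓ
Greatest P i = P i × (∀ {j} → P j → j Fin.≤ i)

greatest? : ∀ {n} {P : Pred (Fin n) 0ℓ} → Decidable P → ∃ (Greatest P) ⊎ (∀ i → ¬ P i)
greatest? {zero} P? = inj₂ λ ()
greatest? {suc n} P? with greatest? (P? ∘ suc)
... | inj₁ (i , p , greatest) =
      inj₁ (suc i , p , λ { {zero} q → z≤n ; {suc j} q → s≤s (greatest q) })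
... | inj₂ none with P? zero
...   | yes p = inj₁ (zero , p , λ { {zero} q → z≤n ; {suc j} q → contradiction q (none j) })
...   | no ¬p = inj₂ λ { zero → ¬p ; (suc i) → none i }

greatest : ∀ {n} {P : Pred (Fin n) 0ℓ} → Decidable P → ∃ P → ∃ (Greatest P)
greatest P? (i , p) with greatest? P?
... | inj₁ g = g
... | inj₂ none = contradiction p (none i)

<-by-≢ : ∀ {n} {i j : Fin n} → i Fin.≤ j → i ≢ j → i Fin.< j
<-by-≢ i≤j i≢j = ℕ.≤∧≢⇒< i≤j (i≢j ∘ Fin.toℕ-injective)

-- A set partition is encoded by the function key sending every element to the
-- maximum of its block, so that the fixed points of key name the blocks.

CrossingKeys : ∀ {n} → (Fin n → Fin n) → Rel (Fin n) 0ℓ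
CrossingKeys key k k′ = k ≢ k′ ×
  ∃[ i ] ∃[ j ] ∃[ l ] ∃[ r ] key i ≡ k × key l ≡ k × key j ≡ k′ × key r ≡ k′ ×
    ((i Fin.< j × j Fin.< l × l Fin.< r) ⊎ (i Fin.> j × j Fin.> l × l Fin.> r))

crossingKeys? : ∀ {n} (key : Fin n → Fin n) k k′ → Dec (CrossingKeys key k k′)
crossingKeys? key k k′ = ¬? (k ≟ k′) ×-dec (any? λ i → any? λ j → any? λ l → any? λ r →
  (key i ≟ k) ×-dec (key l ≟ k) ×-dec (key j ≟ k′) ×-dec (key r ≟ k′) ×-dec
  (((i Fin.<? j) ×-dec (j Fin.<? l) ×-dec (l Fin.<? r)) ⊎-dec
   ((j Fin.<? i) ×-dec (l Fin.<? j) ×-dec (r Fin.<? l))))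

-- Acyclicity appears as well-foundedness of `⟶`, which allows recursion along in-neighbours. The
-- fields `root` and `parent` make the block of `fromℕ m` a source and the only one; connectedness
-- results from following `parent` back to that block.
record IsRooted {m} (key : Value m → Value m) (_⟶_ : Rel (Value m) 0ℓ) : Set where
  field
    key-≤    : ∀ v → v Fin.≤ key v
    key-idem : ∀ v → key (key v) ≡ key v
    crossing : ∀ {k k′} → k ⟶ k′ → CrossingKeys key k k′
    orient   : ∀ {k k′} → CrossingKeys key k k′ → k ⟶ k′ ⊎ k′ ⟶ k
    wf       : WellFounded _⟶_
    root     : ∀ {k} → ¬ k ⟶ fromℕ m
    parent   : ∀ {k} → key k ≡ k → k ≢ fromℕ m → ∃[ k′ ] k′ ⟶ k

  crossing-keyˡ : ∀ {k k′} → CrossingKeys key k k′ → key k ≡ k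
  crossing-keyˡ (_ , i , _ , _ , _ , refl , _) = key-idem i

  crossing-keyʳ : ∀ {k k′} → CrossingKeys key k k′ → key k′ ≡ k′
  crossing-keyʳ (_ , _ , j , _ , _ , _ , _ , refl , _) = key-idem j

  top-key : key (fromℕ m) ≡ fromℕ m
  top-key = Fin.≤-antisym (Fin.≤fromℕ _) (key-≤ _)

  -- Crossing is decidable, and well-foundedness makes `⟶` asymmetric, so the direction that
  -- `orient` returns excludes the other.
  _⟶?_ : ∀ k k′ → Dec (k ⟶ k′)
  k ⟶? k′ with crossingKeys? key k k′
  ... | no ¬crossing = no (¬crossing ∘ crossing)
  ... | yes c with orient c
  ...   | inj₁ e = yes e
  ...   | inj₂ e = no (wf⇒asym wf e)

CrossingKeys-sym : ∀ {n} {key : Fin n → Fin n} {k k′} → CrossingKeys key k k′ → CrossingKeys key k′ k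
CrossingKeys-sym (k≢k′ , i , j , l , r , i∈ , l∈ , j∈ , r∈ , order) =
  k≢k′ ∘ sym , r , l , j , i , r∈ , j∈ , l∈ , i∈ ,
  swap (Sum.map (λ (a , b , c) → c , b , a) (λ (a , b , c) → c , b , a) order)
CrossingKeys-resp : ∀ {n} {key key′ : Fin n → Fin n} → key ≗ key′ → ∀ {k k′} →
                    CrossingKeys key k k′ → CrossingKeys key′ k k′
CrossingKeys-resp eq (k≢k′ , i , j , l , r , i∈ , l∈ , j∈ , r∈ , order) =
  k≢k′ , i , j , l , r , trans (sym (eq i)) i∈ , trans (sym (eq l)) l∈ ,
  trans (sym (eq j)) j∈ , trans (sym (eq r)) r∈ , order

-- Blocks as subsets and as keys

module _ {n} (key : Fin n → Fin n) where

  IsBlock : Subset n → Fin n → Set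
  IsBlock B k = ∀ u → u ∈ B ⇔ key u ≡ k

  block : Fin n → Subset n
  block k = Vec.tabulate λ u → does (key u ≟ k)

  block-isBlock : ∀ k → IsBlock (block k) k
  block-isBlock k u = mk⇔
    (λ u∈B → toWitness′ (trans (sym (Vec.lookup∘tabulate _ u)) (Vec.[]=⇒lookup u∈B)))
    (λ eq → Vec.lookup⇒[]= u _ (trans (Vec.lookup∘tabulate _ u) (dec-true (key u ≟ k) eq)))
    where
    toWitness′ : does (key u ≟ k) ≡ true → key u ≡ k
    toWitness′ eq with yes p ← key u ≟ k = p

  isBlock-unique : ∀ {B B′ k} → IsBlock B k → IsBlock B′ k → B ≡ B′
  isBlock-unique b b′ = ⊆-antisym (λ {u} u∈ → from (b′ u) (to (b u) u∈))
                                  (λ {u} u∈ → from (b u) (to (b′ u) u∈))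

  isBlock-key : ∀ {B k k′} → key k ≡ k → IsBlock B k → IsBlock B k′ → k ≡ k′
  isBlock-key {k = k} k-key b b′ = trans (sym k-key) (to (b′ k) (from (b k) k-key))

  crossing-blocks : ∀ {B B′ k k′} → IsBlock B k → IsBlock B′ k′ →
                    CrossingKeys key k k′ → Crossing B B′
  crossing-blocks b b′ (k≢k′ , i , j , l , r , i∈ , l∈ , j∈ , r∈ , order) =
    (λ { refl → k≢k′ (trans (sym i∈) (to (b′ i) (from (b i) i∈))) }) ,
    i , j , l , r , from (b i) i∈ , from (b l) l∈ , from (b′ j) j∈ , from (b′ r) r∈ , order

  crossing-keys : ∀ {B B′ k k′} → IsBlock B k → IsBlock B′ k′ →
                  Crossing B B′ → CrossingKeys key k k′
  crossing-keys b b′ (B≢B′ , i , j , l , r , i∈ , l∈ , j∈ , r∈ , order) =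
    (λ { refl → B≢B′ (isBlock-unique b b′) }) ,
    i , j , l , r , to (b i) i∈ , to (b l) l∈ , to (b′ j) j∈ , to (b′ r) r∈ , order

-- Dictionary between an oriented family of subsets and its encoding by block maxima. The
-- combinatorics is done with `key` and `⟶` and transported through it.
record Represents {m} (ρα : OrientedFamily (suc m))
                  (key : Value m → Value m) (_⟶_ : Rel (Value m) 0ℓ) : Set where
  field
    family⇔ : ∀ B → proj₁ ρα B ⇔ (∃[ k ] key k ≡ k × IsBlock key B k)
    arrow⇔  : ∀ B B′ → proj₂ ρα B B′ ⇔
              (∃[ k ] ∃[ k′ ] IsBlock key B k × IsBlock key B′ k′ × k ⟶ k′)

module _ {m} {ρα : OrientedFamily (suc m)} {key : Value m → Value m} {_⟶_ : Rel (Value m) 0ℓ}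
         (rooted : IsRooted key _⟶_) (represents : Represents ρα key _⟶_) where
  open IsRooted rooted
  open Represents represents

  private
    ρ = proj₁ ρα
    α = proj₂ ρα

    graph : ∀ {k k′} → CrossingKeys key k k′ → CrossingGraph ρ (block key k) (block key k′)
    graph {k} {k′} c =
      from (family⇔ _) (k , crossing-keyˡ c , block-isBlock key k) ,
      from (family⇔ _) (k′ , crossing-keyʳ c , block-isBlock key k′) ,
      crossing-blocks key (block-isBlock key k) (block-isBlock key k′) c

    graph-sym : ∀ {B B′} → CrossingGraph ρ B B′ → CrossingGraph ρ B′ B
    graph-sym {B} {B′} (B∈ρ , B′∈ρ , c)
      with k , _ , b ← to (family⇔ B) B∈ρ | k′ , _ , b′ ← to (family⇔ B′) B′∈ρ =
      B′∈ρ , B∈ρ , crossing-blocks key b′ b (CrossingKeys-sym {key = key} (crossing-keys key b b′ c))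

    -- Going against the arrows with `parent` stops by well-foundedness, and it can stop only at the
    -- block of `fromℕ m`.
    toRoot : ∀ k → key k ≡ k → Acc _⟶_ k → Star (CrossingGraph ρ) (block key k) (block key (fromℕ m))
    toRoot k k-key (acc rec) with k ≟ fromℕ m
    ... | yes refl = ε
    ... | no k≢top with k′ , e ← parent k-key k≢top =
      graph (CrossingKeys-sym {key = key} (crossing e)) ◅
      toRoot k′ (crossing-keyˡ (crossing e)) (rec e)

    path : ∀ {B B′} → ρ B → ρ B′ → Star (CrossingGraph ρ) B B′
    path {B} {B′} B∈ρ B′∈ρ
      with k , k-key , b ← to (family⇔ B) B∈ρ | k′ , k′-key , b′ ← to (family⇔ B′) B′∈ρ
      with refl ← isBlock-unique key b (block-isBlock key k)
         | refl ← isBlock-unique key b′ (block-isBlock key k′) =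
      toRoot k k-key (wf k) ◅◅ Star.reverse graph-sym (toRoot k′ k′-key (wf k′))

    chain : ∀ {B B′ k k′} → IsBlock key B k → IsBlock key B′ k′ → TransClosure α B B′ →
            TransClosure _⟶_ k k′
    chain b b′ [ e ] with k₁ , k₂ , b₁ , b₂ , e′ ← to (arrow⇔ _ _) e
      with refl ← isBlock-key key (crossing-keyˡ (crossing e′)) b₁ b
         | refl ← isBlock-key key (crossing-keyʳ (crossing e′)) b₂ b′ = [ e′ ]
    chain b b′ (e ∷ es) with k₁ , k₂ , b₁ , b₂ , e′ ← to (arrow⇔ _ _) e
      with refl ← isBlock-key key (crossing-keyˡ (crossing e′)) b₁ b = e′ ∷ chain b₂ b′ es

    start : ∀ {B B′} → TransClosure α B B′ → ∃ (IsBlock key B)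
    start [ e ]   = let k , _ , b , _ = to (arrow⇔ _ _) e in k , b
    start (e ∷ _) = let k , _ , b , _ = to (arrow⇔ _ _) e in k , b

    acyclicity : Acyclic α
    acyclicity cycle = let k , b = start cycle in
      wf⇒irrefl (resp₂ _) sym (Plus.wellFounded _⟶_ wf) refl (chain b b cycle)

  isAcyclicConnected : IsAcyclicConnected ρα
  isAcyclicConnected = record
    { isPartition = record
      { nonempty = λ {B} B∈ρ → let k , k-key , b = to (family⇔ B) B∈ρ in k , from (b k) k-key
      ; cover    = λ i → block key (key i) ,
                   from (family⇔ _) (key i , key-idem i , block-isBlock key (key i)) ,
                   from (block-isBlock key (key i) i) refl
      ; disjoint = λ {B} {B′} {i} B∈ρ B′∈ρ i∈B i∈B′ →
          let k , _ , b = to (family⇔ B) B∈ρ ; k′ , _ , b′ = to (family⇔ B′) B′∈ρ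
              k≡k′ = trans (sym (to (b i) i∈B)) (to (b′ i) i∈B′)
          in isBlock-unique key (subst (IsBlock key B) k≡k′ b) b′
      }
    ; connected = path
    ; isOrientation = record
      { edge   = λ {B} {B′} e → let k , k′ , b , b′ , e′ = to (arrow⇔ B B′) e ; c = crossing e′ in
                 from (family⇔ B) (k , crossing-keyˡ c , b) ,
                 from (family⇔ B′) (k′ , crossing-keyʳ c , b′) , crossing-blocks key b b′ c
      ; orient = λ {B} {B′} (B∈ρ , B′∈ρ , c) →
          let k , _ , b = to (family⇔ B) B∈ρ ; k′ , _ , b′ = to (family⇔ B′) B′∈ρ in
          Sum.map (λ e → from (arrow⇔ _ _) (k , k′ , b , b′ , e))
                       (λ e → from (arrow⇔ _ _) (k′ , k , b′ , b , e))
                       (orient (crossing-keys key b b′ c))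
      ; oneWay = λ e e′ → acyclicity (e ∷ [ e′ ])
      }
    ; acyclic = acyclicity
    ; onlySource = λ {B} B∈ρ → let k , k-key , b = to (family⇔ B) B∈ρ in mk⇔
        (λ (_ , source) → rootBlock b k-key source)
        (λ top∈B → B∈ρ , λ B′ e →
          let l , k′ , _ , b′ , e′ = to (arrow⇔ B′ B) e in
          root (subst (l ⟶_) (trans (sym (to (b′ _) top∈B)) top-key) e′))
    }
    where
    rootBlock : ∀ {B k} → IsBlock key B k → key k ≡ k → (∀ B′ → ¬ α B′ B) → fromℕ m ∈ B
    rootBlock {k = k} b k-key source with k ≟ fromℕ m
    ... | yes refl = from (b _) k-key
    ... | no k≢top with k′ , e ← parent k-key k≢top =
      contradiction (from (arrow⇔ _ _) (k′ , k , block-isBlock key k′ , b , e)) (source _)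

module _ {m} {ρα ρα′ : OrientedFamily (suc m)} {key key′ : Value m → Value m}
         {_⟶_ _⟶′_ : Rel (Value m) 0ℓ}
         (represents : Represents ρα key _⟶_) (represents′ : Represents ρα′ key′ _⟶′_) where
  private
    module R = Represents represents
    module R′ = Represents represents′

  represents-⊆ : key ≗ key′ → (∀ {k k′} → k ⟶ k′ → k ⟶′ k′) →
                 (∀ B → proj₁ ρα B → proj₁ ρα′ B) × (∀ B B′ → proj₂ ρα B B′ → proj₂ ρα′ B B′)
  represents-⊆ key≗ ⟶⇒ =
    (λ B B∈ → let k , k-key , b = to (R.family⇔ B) B∈ in
      from (R′.family⇔ B) (k , trans (sym (key≗ k)) k-key , isBlock b)) ,
    (λ B B′ e → let k , k′ , b , b′ , e′ = to (R.arrow⇔ B B′) e in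
      from (R′.arrow⇔ B B′) (k , k′ , isBlock b , isBlock b′ , ⟶⇒ e′))
    where
    isBlock : ∀ {B k} → IsBlock key B k → IsBlock key′ B k
    isBlock b u = mk⇔ (λ u∈ → trans (sym (key≗ u)) (to (b u) u∈))
                      (λ eq → from (b u) (trans (key≗ u) eq))

  -- The block of `v` for `key` is also a block for `key′`. Both of its names are its maximum: each
  -- belongs to the block and is bounded by the other through `key-≤`.
  represents-key : IsRooted key _⟶_ → IsRooted key′ _⟶′_ →
                   (∀ B → proj₁ ρα B → proj₁ ρα′ B) → key ≗ key′
  represents-key rooted rooted′ ρ⊆ v
    with k , k-key , b ← to (R′.family⇔ _) (ρ⊆ _ (from (R.family⇔ _)
                           (key v , IsRooted.key-idem rooted v , block-isBlock key (key v)))) =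
    trans (Fin.≤-antisym
      (subst (key v Fin.≤_) (to (b _) (from (block-isBlock key _ _) (IsRooted.key-idem rooted v)))
        (IsRooted.key-≤ rooted′ (key v)))
      (subst (k Fin.≤_) (to (block-isBlock key _ k) (from (b k) k-key)) (IsRooted.key-≤ rooted k)))
    (sym (to (b v) (from (block-isBlock key _ v) refl)))

  represents-arrow : IsRooted key _⟶_ → key ≗ key′ →
                     (∀ B B′ → proj₂ ρα B B′ → proj₂ ρα′ B B′) → ∀ {k k′} → k ⟶ k′ → k ⟶′ k′
  represents-arrow rooted key≗ α⊆ {k} {k′} e
    with l , l′ , b , b′ , e′ ← to (R′.arrow⇔ _ _) (α⊆ _ _ (from (R.arrow⇔ _ _)
                                  (k , k′ , block-isBlock key k , block-isBlock key k′ , e))) =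
    subst₂ _⟶′_ (sym (same (crossing-keyˡ (crossing e)) b)) (sym (same (crossing-keyʳ (crossing e)) b′)) e′
    where
    open IsRooted rooted
    same : ∀ {k l} → key k ≡ k → IsBlock key′ (block key k) l → k ≡ l
    same {k} k-key b = trans (sym k-key) (trans (key≗ k) (to (b k) (from (block-isBlock key k k) k-key)))

-- Keys and arrows of a given oriented partition

module _ {m} {ρα : OrientedFamily (suc m)} (isAC : IsAcyclicConnected ρα) where
  open IsAcyclicConnected isAC
  open IsPartition isPartition
  open IsOrientation isOrientation using (edge; oneWay) renaming (orient to orientBlocks)
  private
    ρ = proj₁ ρα
    α = proj₂ ρα

    blockOf : Value m → Subset (suc m)
    blockOf v = proj₁ (cover v)

    blockOf∈ρ : ∀ v → ρ (blockOf v)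
    blockOf∈ρ v = proj₁ (proj₂ (cover v))

    ∈blockOf : ∀ v → v ∈ blockOf v
    ∈blockOf v = proj₂ (proj₂ (cover v))

    blockOf-∈ : ∀ {B v} → ρ B → v ∈ B → blockOf v ≡ B
    blockOf-∈ {v = v} B∈ρ v∈B = disjoint (blockOf∈ρ v) B∈ρ (∈blockOf v) v∈B

    maximum : ∀ v → ∃ (Greatest (_∈ blockOf v))
    maximum v = greatest (_∈? blockOf v) (v , ∈blockOf v)

  keyOf : Value m → Value m
  keyOf v = proj₁ (maximum v)

  arrowOf : Rel (Value m) 0ℓ
  arrowOf k k′ = α (block keyOf k) (block keyOf k′)

  private
    keyOf∈ : ∀ v → keyOf v ∈ blockOf v
    keyOf∈ v = proj₁ (proj₂ (maximum v))

    keyOf-cong : ∀ {u v} → u ∈ blockOf v → keyOf u ≡ keyOf v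
    keyOf-cong {u} {v} u∈ = Fin.≤-antisym
      (proj₂ (proj₂ (maximum v)) (subst (keyOf u ∈_) (blockOf-∈ (blockOf∈ρ v) u∈) (keyOf∈ u)))
      (proj₂ (proj₂ (maximum u)) (subst (keyOf v ∈_) (sym (blockOf-∈ (blockOf∈ρ v) u∈)) (keyOf∈ v)))

    keyOf-≡ : ∀ {u v} → keyOf u ≡ keyOf v → u ∈ blockOf v
    keyOf-≡ {u} {v} eq = subst (u ∈_)
      (disjoint (blockOf∈ρ u) (blockOf∈ρ v) (subst (_∈ blockOf u) eq (keyOf∈ u)) (keyOf∈ v)) (∈blockOf u)

    keyOf-idem : ∀ v → keyOf (keyOf v) ≡ keyOf v
    keyOf-idem v = keyOf-cong (keyOf∈ v)

    blockOf-isBlock : ∀ {k} v → keyOf v ≡ k → IsBlock keyOf (blockOf v) k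
    blockOf-isBlock v refl u = mk⇔ keyOf-cong keyOf-≡

    block∈ρ : ∀ {k} → keyOf k ≡ k → ρ (block keyOf k)
    block∈ρ {k} k-key = subst ρ
      (isBlock-unique keyOf (blockOf-isBlock k k-key) (block-isBlock keyOf k)) (blockOf∈ρ k)

    member : ∀ {B} → ρ B → ∃[ v ] blockOf v ≡ B
    member B∈ρ = let v , v∈B = nonempty B∈ρ in v , blockOf-∈ B∈ρ v∈B

    isBlockOf : ∀ {B} → ρ B → ∃[ k ] keyOf k ≡ k × IsBlock keyOf B k
    isBlockOf B∈ρ with v , refl ← member B∈ρ = keyOf v , keyOf-idem v , blockOf-isBlock v refl

    keysCross : ∀ {k k′} → CrossingKeys keyOf k k′ → CrossingGraph ρ (block keyOf k) (block keyOf k′)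
    keysCross {k} {k′} c@(_ , i , j , _ , _ , refl , _ , refl , _) =
      block∈ρ (keyOf-idem i) , block∈ρ (keyOf-idem j) ,
      crossing-blocks keyOf (block-isBlock keyOf _) (block-isBlock keyOf _) c

    blockChain : ∀ {k k′} → TransClosure arrowOf k k′ → TransClosure α (block keyOf k) (block keyOf k′)
    blockChain [ e ] = [ e ]
    blockChain (e ∷ es) = e ∷ blockChain es

    -- By acyclicity the transitive closure is a strict partial order on a finite set, hence
    -- well-founded.
    wellFounded : WellFounded arrowOf
    wellFounded = Plus.wellFounded⁻ arrowOf (spo-wellFounded record
      { isEquivalence = isEquivalence
      ; irrefl = λ { refl cycle → acyclic (blockChain cycle) }
      ; trans = Plus._++_
      ; <-resp-≈ = resp₂ _
      })

    -- A block without in-neighbours is a source, so it contains `fromℕ m`, which is then its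
    -- maximum. Decidability of the arrows turns this into an actual in-neighbour.
    noSource : ∀ {k} → keyOf k ≡ k → k ≢ fromℕ m → ∃[ k′ ] arrowOf k′ k
    noSource {k} k-key k≢top = Dec.decidable-stable (any? λ k′ → arrow? k′ k) λ none →
      k≢top (trans
        (sym (to (block-isBlock keyOf k _) (to (onlySource (block∈ρ k-key)) (block∈ρ k-key , λ B′ e →
          let k′ , _ , b = isBlockOf (proj₁ (edge e)) in
          none (k′ , subst (λ B → α B _) (isBlock-unique keyOf b (block-isBlock keyOf k′)) e)))))
        (Fin.≤-antisym (Fin.≤fromℕ _) (proj₂ (proj₂ (maximum _)) (∈blockOf _))))
      where
      arrow? : ∀ k k′ → Dec (arrowOf k k′)
      arrow? k k′ with crossingKeys? keyOf k k′
      ... | no ¬crossing = no λ e → ¬crossing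
              (crossing-keys keyOf (block-isBlock keyOf k) (block-isBlock keyOf k′) (proj₂ (proj₂ (edge e))))
      ... | yes c with orientBlocks (keysCross c)
      ...   | inj₁ e = yes e
      ...   | inj₂ e = no (oneWay e)
  keyOf-isRooted : IsRooted keyOf arrowOf
  keyOf-isRooted = record
    { key-≤    = λ v → proj₂ (proj₂ (maximum v)) (∈blockOf v)
    ; key-idem = keyOf-idem
    ; crossing = λ e → crossing-keys keyOf (block-isBlock keyOf _) (block-isBlock keyOf _)
                         (proj₂ (proj₂ (edge e)))
    ; orient   = λ c → orientBlocks (keysCross c)
    ; wf       = wellFounded
    ; root     = λ {k} e →
        let _ , B∈ρ , _ = edge e in
        proj₂ (from (onlySource B∈ρ) (from (block-isBlock keyOf (fromℕ m) (fromℕ m))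
          (Fin.≤-antisym (Fin.≤fromℕ _) (proj₂ (proj₂ (maximum _)) (∈blockOf _))))) _ e
    ; parent   = noSource
    }

  keyOf-represents : Represents ρα keyOf arrowOf
  keyOf-represents = record
    { family⇔ = λ B → mk⇔ isBlockOf λ (k , k-key , b) →
        subst ρ (isBlock-unique keyOf (block-isBlock keyOf k) b) (block∈ρ k-key)
    ; arrow⇔ = λ B B′ → mk⇔
        (λ e → let B∈ρ , B′∈ρ , _ = edge e
                   k , _ , b = isBlockOf B∈ρ ; k′ , _ , b′ = isBlockOf B′∈ρ in
          k , k′ , b , b′ , subst₂ α (isBlock-unique keyOf b (block-isBlock keyOf k))
                                     (isBlock-unique keyOf b′ (block-isBlock keyOf k′)) e)
        (λ (k , k′ , b , b′ , e) → subst₂ α (isBlock-unique keyOf (block-isBlock keyOf k) b)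
                                            (isBlock-unique keyOf (block-isBlock keyOf k′) b′) e)
    }

-- The greedy rule

module Greedy {m} (key : Value m → Value m) (_⟶_ : Rel (Value m) 0ℓ) (w : ℕ → Value m) where

  -- At time `t` the values `w 0`, ..., `w t` are placed, and `Step t y` puts `y` at position
  -- `suc t`. Only these entries of `w` enter, so the rule makes sense for a word that is still
  -- being built.
  Placed Touched Remaining Available Candidate Target : ℕ → Pred (Value m) 0ℓ
  Placed t v    = ∃[ s ] s ≤ t × w s ≡ v
  Touched t k   = ∃[ s ] s ≤ t × key (w s) ≡ k
  Remaining t v = ¬ Placed t v × Touched t (key v)
  Available t k = key k ≡ k × ¬ Touched t k × (∃[ u ] key u ≡ k × u Fin.< w t) × w t Fin.< k ×
                  (∀ k′ → k′ ⟶ k → Touched t k′)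
  Candidate t v = Remaining t v ⊎ Available t v
  Target t      = Least (Candidate t)

  Next : ℕ → Value m → Pred (Value m) 0ℓ
  Next t z = Least (λ v → ¬ Placed t v × key v ≡ key z)

  Step : ℕ → Pred (Value m) 0ℓ
  Step t y = ∃[ z ] Target t z × Next t z y

  candidate-unplaced : ∀ {t v} → Candidate t v → ¬ Placed t v
  candidate-unplaced (inj₁ (¬placed , _)) = ¬placed
  candidate-unplaced (inj₂ (v-key , ¬touched , _)) (s , s≤t , eq) =
    ¬touched (s , s≤t , trans (cong key eq) v-key)

  placed? : ∀ t → Decidable (Placed t)
  placed? t v = map′ (λ (s , s< , eq) → s , s≤s⁻¹ s< , eq) (λ (s , s≤ , eq) → s , s≤s s≤ , eq)
    (ℕ.anyUpTo? (λ s → w s ≟ v) (suc t))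

  touched? : ∀ t → Decidable (Touched t)
  touched? t k = map′ (λ (s , s< , eq) → s , s≤s⁻¹ s< , eq) (λ (s , s≤ , eq) → s , s≤s s≤ , eq)
    (ℕ.anyUpTo? (λ s → key (w s) ≟ k) (suc t))

  record IsGreedy (T : ℕ) : Set where
    field
      start : Least (λ v → key v ≡ fromℕ m) (w 0)
      step  : ∀ {t} → t < T → Step t (w (suc t))

open Greedy using (IsGreedy; module IsGreedy)

module _ {m} {key key′ : Value m → Value m} {_⟶_ _⟶′_ : Rel (Value m) 0ℓ} {w w′ : ℕ → Value m}
         (key≗ : key ≗ key′) (⟶⇔ : ∀ k k′ → k ⟶ k′ ⇔ k ⟶′ k′) where
  private
    module G = Greedy key _⟶_ w
    module G′ = Greedy key′ _⟶′_ w′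

  candidate-resp : ∀ {t} → (∀ {s} → s ≤ t → w s ≡ w′ s) → ∀ {v} → G.Candidate t v → G′.Candidate t v
  candidate-resp {t} w≡ {v} = Sum.map
    (λ (¬placed , touched) → ¬placed ∘ placed , subst (G′.Touched t) (key≗ v) (touch touched))
    (λ (v-key , ¬touched , (u , u∈ , u<) , <v , incoming) →
      trans (sym (key≗ v)) v-key , ¬touched ∘ touch⁻ ,
      (u , trans (sym (key≗ u)) u∈ , subst (u Fin.<_) (w≡ ℕ.≤-refl) u<) ,
      subst (Fin._< v) (w≡ ℕ.≤-refl) <v ,
      λ k′ e → touch (incoming k′ (from (⟶⇔ k′ v) e)))
    where
    placed : ∀ {v} → G′.Placed t v → G.Placed t v
    placed (s , s≤t , eq) = s , s≤t , trans (w≡ s≤t) eq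
    touch : ∀ {k} → G.Touched t k → G′.Touched t k
    touch (s , s≤t , eq) = s , s≤t , trans (sym (key≗ _)) (trans (cong key (sym (w≡ s≤t))) eq)
    touch⁻ : ∀ {k} → G′.Touched t k → G.Touched t k
    touch⁻ (s , s≤t , eq) = s , s≤t , trans (cong key (w≡ s≤t)) (trans (key≗ _) eq)

  next-resp : ∀ {t} → (∀ {s} → s ≤ t → w s ≡ w′ s) → ∀ {z v} →
              ¬ G.Placed t v × key v ≡ key z → ¬ G′.Placed t v × key′ v ≡ key′ z
  next-resp w≡ {z} {v} (¬placed , eq) =
    (λ (s , s≤t , eq) → ¬placed (s , s≤t , trans (w≡ s≤t) eq)) ,
    trans (sym (key≗ v)) (trans eq (key≗ z))

module _ {m} {key key′ : Value m → Value m} {_⟶_ _⟶′_ : Rel (Value m) 0ℓ} {w w′ : ℕ → Value m}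
         (key≗ : key ≗ key′) (⟶⇔ : ∀ k k′ → k ⟶ k′ ⇔ k ⟶′ k′) where
  private
    module G = Greedy key _⟶_ w
    module G′ = Greedy key′ _⟶′_ w′

    ⟶⇔⁻ : ∀ k k′ → k ⟶′ k′ ⇔ k ⟶ k′
    ⟶⇔⁻ k k′ = mk⇔ (from (⟶⇔ k k′)) (to (⟶⇔ k k′))

  step-unique : ∀ {t} → (∀ {s} → s ≤ t → w s ≡ w′ s) →
                ∀ {y y′} → G.Step t y → G′.Step t y′ → y ≡ y′
  step-unique w≡ (z , target , next) (z′ , target′ , next′)
    with refl ← Least-unique (candidate-resp {w = w} {w′} key≗ ⟶⇔ w≡)
                  (candidate-resp {w = w′} {w} (sym ∘ key≗) ⟶⇔⁻ (λ s≤ → sym (w≡ s≤))) target target′ =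
    Least-unique (next-resp {w = w} {w′} key≗ ⟶⇔ w≡ {z})
      (next-resp {w = w′} {w} (sym ∘ key≗) ⟶⇔⁻ (λ s≤ → sym (w≡ s≤)) {z}) next next′

  greedy-unique : ∀ {T} → G.IsGreedy T → G′.IsGreedy T → ∀ {t} → t ≤ T → w t ≡ w′ t
  greedy-unique {T} greedy greedy′ t≤T = below t≤T ℕ.≤-refl
    where
    module I = G.IsGreedy greedy
    module I′ = G′.IsGreedy greedy′
    -- Agreement is carried for all `s ≤ t` at once, because a step refers to the whole prefix.
    below : ∀ {t s} → t ≤ T → s ≤ t → w s ≡ w′ s
    below {zero} _ z≤n = Least-unique (λ {v} → trans (sym (key≗ v))) (λ {v} → trans (key≗ v)) I.start I′.start
    below {suc t} t<T s≤ with ℕ.m≤n⇒m<n∨m≡n s≤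
    ... | inj₁ (s≤s s≤t) = below (ℕ.<⇒≤ t<T) s≤t
    ... | inj₂ refl = step-unique (below (ℕ.<⇒≤ t<T)) (I.step t<T) (I′.step t<T)

step-resp : ∀ {m} {key : Value m → Value m} {_⟶_ : Rel (Value m) 0ℓ} {w w′ : ℕ → Value m} {t} →
            (∀ {s} → s ≤ t → w s ≡ w′ s) → ∀ {y} → Greedy.Step key _⟶_ w t y → Greedy.Step key _⟶_ w′ t y
step-resp {key = key} {_⟶_} {w} {w′} w≡ (z , (cand , z≤) , (next , y≤)) =
  z , (candidate-resp {w = w} {w′} (λ _ → refl) same w≡ cand ,
       λ c → z≤ (candidate-resp {w = w′} {w} (λ _ → refl) same (λ s≤ → sym (w≡ s≤)) c)) ,
  (next-resp {w = w} {w′} (λ _ → refl) same w≡ {z} next ,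
   λ n → y≤ (next-resp {w = w′} {w} (λ _ → refl) same (λ s≤ → sym (w≡ s≤)) {z} n))
  where
  same : ∀ k k′ → k ⟶ k′ ⇔ k ⟶ k′
  same _ _ = mk⇔ id id

-- Words with a laminar family of intervals

-- Position m carries the value n, and Iv 0 m is the block of n.
record Intervals {m} (w : ℕ → Value m) (Iv : ℕ → ℕ → Set) : Set where
  field
    w-injective : ∀ {i j} → i ≤ m → j ≤ m → w i ≡ w j → i ≡ j
    position    : Value m → ℕ
    position≤   : ∀ v → position v ≤ m
    w-position  : ∀ v → w (position v) ≡ v
    w-top       : w m ≡ fromℕ m
    sky         : Iv 0 m
    ordered     : ∀ {o j} → Iv o j → o ≤ j
    bounded     : ∀ {o j} → Iv o j → j ≤ m
    unique      : ∀ {o j j′} → Iv o j → Iv o j′ → j ≡ j′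
    laminar     : ∀ {o j o′ j′} → Iv o j → Iv o′ j′ → o < o′ → o′ ≤ j → j′ < j
    peak        : ∀ {o j l} → Iv o j → o ≤ l → l < j → w l Fin.< w j
    descent     : ∀ {d j} → Iv (suc d) j → w (suc d) Fin.< w d
    above       : ∀ {d j} → Iv (suc d) j → w d Fin.< w j
    ascent      : ∀ {s} → s < m → (∃[ j ] Iv (suc s) j) ⊎ ((∀ {j} → ¬ Iv (suc s) j) × w s Fin.< w (suc s))
    last        : ℕ → ℕ
    innermost   : ∀ {l} → l ≤ m → ∃[ o ] Iv o (last l) × o ≤ l × l ≤ last l ×
                  (∀ {o′ j′} → Iv o′ j′ → o < o′ → o′ ≤ l → j′ < l)

  -- By `laminar` an interval opening inside another ends strictly before it, so a shared right end
  -- forces a shared start.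
  unique′ : ∀ {o o′ j} → Iv o j → Iv o′ j → o ≡ o′
  unique′ {o} {o′} iv iv′ with ℕ.<-cmp o o′
  ... | tri< o<o′ _ _ = contradiction (laminar iv iv′ o<o′ (ordered iv′)) (ℕ.<-irrefl refl)
  ... | tri≈ _ o≡o′ _ = o≡o′
  ... | tri> _ _ o′<o = contradiction (laminar iv′ iv o′<o (ordered iv)) (ℕ.<-irrefl refl)

  -- The last hypothesis says that whatever opens after `o`, up to `l`, has ended before `l`, so
  -- that `[o , j]` is the innermost interval around `l`. If two intervals had this property, the
  -- one opening later would have ended before `l`.
  last-unique : ∀ {l o j} → Iv o j → o ≤ l → l ≤ j →
                (∀ {o′ j′} → Iv o′ j′ → o < o′ → o′ ≤ l → j′ < l) → last l ≡ j
  last-unique {l} {o} iv o≤l l≤j inner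
    with o₁ , iv₁ , o₁≤l , l≤ , inner₁ ← innermost (ℕ.≤-trans l≤j (bounded iv))
    with ℕ.<-cmp o o₁
  ... | tri< o<o₁ _ _ = contradiction l≤ (ℕ.<⇒≱ (inner iv₁ o<o₁ o₁≤l))
  ... | tri≈ _ refl _ = unique iv₁ iv
  ... | tri> _ _ o₁<o = contradiction l≤j (ℕ.<⇒≱ (inner₁ iv o₁<o o≤l))

  last-end : ∀ {o j} → Iv o j → last j ≡ j
  last-end iv = last-unique iv (ordered iv) ℕ.≤-refl (laminar iv)

  last-start : ∀ {o j} → Iv o j → last o ≡ j
  last-start iv = last-unique iv ℕ.≤-refl (ordered iv)
    (λ _ o<o′ o′≤o → contradiction o′≤o (ℕ.<⇒≱ o<o′))

  last-≥start : ∀ {o j l} → Iv o j → l ≤ m → last l ≡ j → o ≤ l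
  last-≥start iv l≤m refl with o , iv′ , o≤l , _ ← innermost l≤m
    with refl ← unique′ iv iv′ = o≤l

  last≤m : ∀ {l} → l ≤ m → last l ≤ m
  last≤m l≤m = let _ , iv , _ = innermost l≤m in bounded iv

  -- The interval of the common block opens at or before `a`, hence before `o`. Being innermost at
  -- `r`, it forces an interval that opens in between to have ended before `r`.
  same-block : ∀ {a r o j} → a ≤ m → r ≤ m → last a ≡ last r → Iv o j → a < o → o ≤ r → ¬ r < j
  same-block a≤m r≤m eq iv a<o o≤r r<j
    with o₁ , iv₁ , _ , _ , inner ← innermost r≤m =
    ℕ.<-asym r<j (inner iv (ℕ.≤-<-trans (last-≥start iv₁ a≤m eq) a<o) o≤r)

  -- Climbs and paths

  data Climb (s : ℕ) : ℕ → Set where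
    ascend : (∀ {j} → ¬ Iv (suc s) j) → w s Fin.< w (suc s) → s < m → Climb s (suc s)
    jump   : ∀ {t} → Iv (suc s) t → Climb s t

  climb-< : ∀ {s t} → Climb s t → s < t
  climb-< (ascend _ _ _) = ℕ.n<1+n _
  climb-< (jump iv) = ordered iv

  climb-w : ∀ {s t} → Climb s t → w s Fin.< w t
  climb-w (ascend _ w< _) = w<
  climb-w (jump iv) = above iv

  climb : ∀ {s} → s < m → ∃ (Climb s)
  climb s<m with ascent s<m
  ... | inj₁ (j , iv) = j , jump iv
  ... | inj₂ (none , w<) = _ , ascend none w< s<m

  climb-past : ∀ {s t r} → Climb s t → s < r → r < t → Iv (suc s) t
  climb-past (ascend _ _ _) s<r r<t = contradiction r<t (ℕ.≤⇒≯ s<r)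
  climb-past (jump iv) _ _ = iv

  infixr 5 _∷_
  data Path : ℕ → ℕ → Set where
    []  : ∀ {l} → Path l l
    _∷_ : ∀ {l t r} → Climb l t → Path t r → Path l r

  path-≤ : ∀ {l r} → Path l r → l ≤ r
  path-≤ [] = ℕ.≤-refl
  path-≤ (c ∷ p) = ℕ.≤-trans (ℕ.<⇒≤ (climb-< c)) (path-≤ p)

  path-w : ∀ {l r} → Path l r → w l Fin.≤ w r
  path-w [] = ℕ.≤-refl
  path-w (c ∷ p) = ℕ.≤-trans (ℕ.<⇒≤ (climb-w c)) (path-w p)

  -- Climb from `l` as long as `r` is not passed. If `r` is not hit exactly, the climb that passes
  -- it is a jump over an interval containing `r` and ending beyond it.
  path : ∀ {l r} → l ≤ r → r ≤ m → Path l r ⊎ (∃[ o ] ∃[ j ] Iv o j × l < o × o ≤ r × r < j)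
  path {l} {r} l≤r r≤m = go l≤r (<-wellFounded (r ∸ l))
    where
    go : ∀ {l} → l ≤ r → Acc _<_ (r ∸ l) → Path l r ⊎ (∃[ o ] ∃[ j ] Iv o j × l < o × o ≤ r × r < j)
    go l≤r (acc rec) with ℕ.m≤n⇒m<n∨m≡n l≤r
    ... | inj₂ refl = inj₁ []
    ... | inj₁ l<r with t , c ← climb (ℕ.<-≤-trans l<r r≤m) with t ≤? r
    ...   | no t≰r = inj₂ (_ , t , climb-past c l<r (ℕ.≰⇒> t≰r) , ℕ.≤-refl , l<r , ℕ.≰⇒> t≰r)
    ...   | yes t≤r with go t≤r (rec (ℕ.∸-monoʳ-< (climb-< c) t≤r))
    ...     | inj₁ p = inj₁ (c ∷ p)
    ...     | inj₂ (o , j , iv , t<o , rest) = inj₂ (o , j , iv , ℕ.<-trans (climb-< c) t<o , rest)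

  block-increasing : ∀ {a r} → r ≤ m → a ≤ r → last a ≡ last r → w a Fin.≤ w r
  block-increasing r≤m a≤r eq with path a≤r r≤m
  ... | inj₁ p = path-w p
  ... | inj₂ (_ , _ , iv , a<o , o≤r , r<j) =
    contradiction r<j (same-block (ℕ.≤-trans a≤r r≤m) r≤m eq iv a<o o≤r)

  -- An ascending climb opens no interval, and a jump goes to the end of the interval it opens and
  -- so over everything nested in it.
  path-closed : ∀ {l s} → Path l s → ∀ {o j} → Iv o j → l < o → o ≤ s → j ≤ s
  path-closed [] iv l<o o≤l = contradiction o≤l (ℕ.<⇒≱ l<o)
  path-closed (_∷_ {t = t} c p) {o} iv l<o o≤s with o ≤? t
  ... | no o≰t = path-closed p iv (ℕ.≰⇒> o≰t) o≤s
  ... | yes o≤t = ℕ.≤-trans (closed c iv l<o o≤t) (path-≤ p)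
    where
    closed : ∀ {s t o j} → Climb s t → Iv o j → s < o → o ≤ t → j ≤ t
    closed (ascend none _ _) iv s<o o≤t with refl ← ℕ.≤-antisym o≤t s<o = contradiction iv none
    closed (jump iv′) iv s<o o≤t with ℕ.m≤n⇒m<n∨m≡n s<o
    ... | inj₁ s+1<o = ℕ.<⇒≤ (laminar iv′ iv s+1<o o≤t)
    ... | inj₂ refl = ℕ.≤-reflexive (unique iv iv′)

  -- Discrete intermediate value argument: the values increase along the path, so one climb passes
  -- the level `c` unless `c` lies below the start.
  threshold : ∀ {l e} → Path l e → (c : Value m) → c Fin.< w e →
              c Fin.≤ w l ⊎ (∃[ s ] ∃[ t ] Path l s × Climb s t × t ≤ e × w s Fin.< c × c Fin.≤ w t × w t Fin.≤ w e)
  threshold [] c c< = inj₁ (ℕ.<⇒≤ c<)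
  threshold (_∷_ {l} {t} st p) c c< with toℕ c ≤? toℕ (w l)
  ... | yes c≤ = inj₁ c≤
  ... | no c≰ with threshold p c c<
  ...   | inj₁ c≤ = inj₂ (l , t , [] , st , path-≤ p , ℕ.≰⇒> c≰ , c≤ , path-w p)
  ...   | inj₂ (s , t′ , q , rest) = inj₂ (s , t′ , st ∷ q , rest)

  key : Value m → Value m
  key v = w (last (position v))

  -- A block's maximum stands at the right end of its interval, so `position k` identifies the
  -- interval. Crossing blocks are oriented from the one opened earlier, which is the order of the
  -- minima of the hats.
  _⟶_ : Rel (Value m) 0ℓ
  k ⟶ k′ = CrossingKeys key k k′ ×
    (∃[ o ] ∃[ o′ ] Iv o (position k) × Iv o′ (position k′) × o < o′)

  position-w : ∀ {l} → l ≤ m → position (w l) ≡ l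
  position-w l≤m = w-injective (position≤ _) l≤m (w-position _)

  key-w : ∀ {l} → l ≤ m → key (w l) ≡ w (last l)
  key-w l≤m = cong (w ∘ last) (position-w l≤m)

  key-end : ∀ {o j} → Iv o j → key (w j) ≡ w j
  key-end iv = trans (key-w (bounded iv)) (cong w (last-end iv))

  key-start : ∀ {o j} → Iv o j → key (w o) ≡ w j
  key-start iv = trans (key-w (ℕ.≤-trans (ordered iv) (bounded iv))) (cong w (last-start iv))

  position-key : ∀ {l v} → l ≤ m → key (w l) ≡ v → position v ≡ last l
  position-key l≤m refl = trans (cong position (key-w l≤m)) (position-w (last≤m l≤m))

  last-≡ : ∀ {a r} → a ≤ m → r ≤ m → key (w a) ≡ key (w r) → last a ≡ last r
  last-≡ a≤m r≤m eq = w-injective (last≤m a≤m) (last≤m r≤m)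
    (trans (sym (key-w a≤m)) (trans eq (key-w r≤m)))

  interval : ∀ {k} → key k ≡ k → ∃[ o ] Iv o (position k)
  interval {k} k-key with o , iv , _ ← innermost (position≤ k) =
    o , subst (Iv o) (sym (position-key (position≤ k) (trans (cong key (w-position k)) k-key))) iv

  open-earlier : ∀ {o j o′ j′} → Iv o j → Iv o′ j′ → o < o′ → CrossingKeys key (w j) (w j′) → w j ⟶ w j′
  open-earlier iv iv′ o<o′ c = c , _ , _ ,
    subst (Iv _) (sym (position-w (bounded iv))) iv ,
    subst (Iv _) (sym (position-w (bounded iv′))) iv′ , o<o′

  -- The values increase along the path from o′ to e; the crossed block is found where they exceed
  -- the minimum w (suc e) of the block ending at j.
  crossed : ∀ {e j o′ j′} → Iv (suc e) j → Iv o′ j′ → o′ ≤ e → e < j′ →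
            ∃[ o ] ∃[ i ] Iv o i × o′ ≤ o × o ≤ e × w i ⟶ w j
  crossed {e} {j} iv iv′ o′≤e e<j′ = go iv′ o′≤e e<j′ (<-wellFounded _)
    where
    j≤m = bounded iv
    e<m = ℕ.<-≤-trans (ordered iv) j≤m

    ≢-w : ∀ {a b} → a ≤ m → b ≤ m → a ≢ b → w a ≢ w b
    ≢-w a≤m b≤m a≢b eq = a≢b (w-injective a≤m b≤m eq)

    strict : ∀ {a} → a ≤ e → w (suc e) Fin.≤ w a → w (suc e) Fin.< w a
    strict a≤e ≤w = <-by-≢ ≤w (≢-w e<m (ℕ.≤-trans a≤e (ℕ.<⇒≤ e<m)) (ℕ.<⇒≢ (s≤s a≤e) ∘ sym))

    -- The values `w i > w j > w a > w (suc e)` alternate between the blocks ending at `i` and `j`.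
    enclosing : ∀ {o i a} → Iv o i → o ≤ e → e < i → a ≤ e → last a ≡ i →
                w (suc e) Fin.≤ w a → w a Fin.≤ w e → w i ⟶ w j
    enclosing {o} {i} {a} ivi o≤e e<i a≤e a∈ ≤wa wa≤ = open-earlier ivi iv (s≤s o≤e)
      (≢-w (bounded ivi) j≤m (ℕ.<⇒≢ j<i ∘ sym) ,
       w i , w j , w a , w (suc e) , key-end ivi ,
       trans (key-w a≤m) (cong w a∈) , key-end iv , key-start iv ,
       inj₂ (peak ivi (ℕ.≤-trans o≤e (ℕ.≤-trans (ℕ.n≤1+n e) (ordered iv))) j<i ,
             ℕ.≤-<-trans wa≤ (above iv) , strict a≤e ≤wa))
      where
      j<i = laminar ivi iv (s≤s o≤e) e<i
      a≤m = ℕ.≤-trans a≤e (ℕ.<⇒≤ e<m)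

    go : ∀ {o′ j′} → Iv o′ j′ → o′ ≤ e → e < j′ → Acc _<_ (e ∸ o′) →
         ∃[ o ] ∃[ i ] Iv o i × o′ ≤ o × o ≤ e × w i ⟶ w j
    go {o′} {j′} iv′ o′≤e e<j′ (acc rec) with path o′≤e (ℕ.<⇒≤ e<m)
    -- Another interval around `e` opens later than `o′`; the search continues inside it.
    ... | inj₂ (o″ , j″ , iv″ , o′<o″ , o″≤e , e<j″)
        with o , i , ivi , o″≤o , rest ← go iv″ o″≤e e<j″ (rec (ℕ.∸-monoʳ-< o′<o″ o″≤e)) =
          o , i , ivi , ℕ.≤-trans (ℕ.<⇒≤ o′<o″) o″≤o , rest
    ... | inj₁ p with threshold p (w (suc e)) (descent iv)
    ...   | inj₁ c≤ = o′ , j′ , iv′ , ℕ.≤-refl , o′≤e ,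
            enclosing iv′ o′≤e e<j′ o′≤e (last-start iv′) c≤ (path-w p)
    -- The level is passed by an ascent. All intervals opened on the way have ended, so position
    -- `suc s` belongs to the enclosing block and serves as `a`.
    ...   | inj₂ (s , _ , q , ascend none _ _ , s<e , _ , c≤ , ≤we) =
            o′ , j′ , iv′ , ℕ.≤-refl , o′≤e ,
            enclosing iv′ o′≤e e<j′ s<e
              (last-unique iv′ (ℕ.m≤n⇒m≤1+n (path-≤ q)) (ℕ.<⇒≤ (ℕ.≤-<-trans s<e e<j′)) inner) c≤ ≤we
      where
      inner : ∀ {o j} → Iv o j → o′ < o → o ≤ suc s → j < suc s
      inner ivo o′<o o≤ with ℕ.m≤n⇒m<n∨m≡n o≤
      ... | inj₁ (s≤s o≤s) = s≤s (path-closed q ivo o′<o o≤s)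
      ... | inj₂ refl = contradiction ivo none
    -- The level is passed by a jump. The block jumped over is the crossing one:
    -- `w (suc s) < w (suc e) < w t < w j` alternate.
    ...   | inj₂ (s , t , q , jump ivt , t≤e , ws< , c≤ , ≤we) =
            suc s , t , ivt , ℕ.m≤n⇒m≤1+n (path-≤ q) , ℕ.≤-trans (ordered ivt) t≤e ,
            open-earlier ivt iv (s≤s (ℕ.≤-trans (ordered ivt) t≤e))
              (≢-w (bounded ivt) j≤m (ℕ.<⇒≢ (ℕ.≤-<-trans t≤e (ordered iv))) ,
               w (suc s) , w (suc e) , w t , w j , key-start ivt , key-end ivt , key-start iv , key-end iv ,
               inj₁ (ℕ.<-trans (descent ivt) ws< , strict t≤e c≤ , ℕ.≤-<-trans ≤we (above iv)))

  private
    key-≤ : ∀ v → v Fin.≤ key v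
    key-≤ v with o , iv , o≤l , l≤ , _ ← innermost (position≤ v) with ℕ.m≤n⇒m<n∨m≡n l≤
    ... | inj₁ l< = subst (Fin._≤ key v) (w-position v) (ℕ.<⇒≤ (peak iv o≤l l<))
    ... | inj₂ eq = ℕ.≤-reflexive (cong toℕ (trans (sym (w-position v)) (cong w eq)))

    key-idem : ∀ v → key (key v) ≡ key v
    key-idem v = key-end (proj₁ (proj₂ (innermost (position≤ v))))

    top-position : position (fromℕ m) ≡ m
    top-position = trans (cong position (sym w-top)) (position-w ℕ.≤-refl)

    opening : ∀ {k k′} → k ⟶ k′ → ∀ {o o′} → Iv o (position k) → Iv o′ (position k′) → o < o′
    opening (_ , _ , _ , iv , iv′ , o<o′) iv₁ iv₁′ = subst₂ _<_ (unique′ iv iv₁) (unique′ iv′ iv₁′) o<o′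

    accessible : ∀ {k o} → Iv o (position k) → Acc _<_ o → Acc _⟶_ k
    accessible iv (acc rec) = acc λ e@(_ , o , o′ , iv₁ , iv₁′ , _) →
      accessible iv₁ (rec (opening e iv₁ iv))

  isRooted : IsRooted key _⟶_
  isRooted = record
    { key-≤    = key-≤
    ; key-idem = key-idem
    ; crossing = proj₁
    ; orient   = orient
    ; wf       = λ k → acc λ { (_ , o , _ , iv , _) → accessible iv (<-wellFounded o) }
    ; root     = λ { (_ , o , o′ , _ , iv′ , o<o′) → contradiction
                   (subst (o <_) (unique′ iv′ (subst (Iv 0) (sym top-position) sky)) o<o′) (λ ()) }
    ; parent   = parent
    }
    where
    orient : ∀ {k k′} → CrossingKeys key k k′ → k ⟶ k′ ⊎ k′ ⟶ k
    orient c@(k≢k′ , i , j , _ , _ , refl , _ , refl , _)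
      with o , iv ← interval (key-idem i) | o′ , iv′ ← interval (key-idem j)
      with ℕ.<-cmp o o′
    ... | tri< o<o′ _ _ = inj₁ (c , o , o′ , iv , iv′ , o<o′)
    ... | tri> _ _ o′<o = inj₂ (CrossingKeys-sym {key = key} c , o′ , o , iv′ , iv , o′<o)
    ... | tri≈ _ refl _ = contradiction
          (trans (sym (w-position _)) (trans (cong w (unique iv iv′)) (w-position _))) k≢k′

    parent : ∀ {k} → key k ≡ k → k ≢ fromℕ m → ∃[ k′ ] k′ ⟶ k
    parent {k} k-key k≢top with interval k-key
    ... | zero , iv = contradiction
          (trans (sym (w-position k)) (trans (cong w (unique iv sky)) w-top)) k≢top
    -- Every block other than the root opens inside the sky interval, to which `crossed` applies.
    ... | suc e , iv with o , i , _ , _ , _ , e ← crossed iv sky z≤n (ℕ.<-≤-trans (ordered iv) (bounded iv)) =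
          w i , subst (w i ⟶_) (w-position k) e

  open Greedy key _⟶_ w hiding (IsGreedy)

  touched-< : ∀ {t o j} → Iv o j → t ≤ m → Touched t (w j) → o ≤ t
  touched-< iv t≤m (s , s≤t , eq) = ℕ.≤-trans
    (last-≥start iv s≤m (trans (sym (position-key s≤m eq)) (position-w (bounded iv)))) s≤t
    where s≤m = ℕ.≤-trans s≤t t≤m

  unplaced : ∀ {t v} → ¬ Placed t v → t < position v
  unplaced ¬placed = ℕ.≰⇒> λ p≤t → ¬placed (_ , p≤t , w-position _)

  not-placed : ∀ {t l} → t < l → l ≤ m → ¬ Placed t (w l)
  not-placed t<l l≤m (s , s≤t , eq) =
    ℕ.<⇒≢ (ℕ.≤-<-trans s≤t t<l) (w-injective (ℕ.≤-trans s≤t (ℕ.<⇒≤ (ℕ.<-≤-trans t<l l≤m))) l≤m eq)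

  -- This shows that a configuration obeys the greedy rule: the position reached by one climb
  -- carries a candidate, and it is at most every remaining value and every available maximum.
  climb-target : ∀ {t t′} → t < m → Climb t t′ → Target t (w t′)
  climb-target {t} {t′} t<m c = candidate c , [ remaining , available ]′
    where
    t≤m = ℕ.<⇒≤ t<m

    candidate : ∀ {t′} → Climb t t′ → Candidate t (w t′)
    -- No interval opens at `suc t`, so the block of `w (suc t)` has opened by time `t`.
    candidate (ascend none _ _) with o , iv , o≤ , _ ← innermost t<m with ℕ.m≤n⇒m<n∨m≡n o≤
    ... | inj₁ (s≤s o≤t) = inj₁ (not-placed (ℕ.n<1+n t) t<m ,
            o , o≤t , trans (key-start iv) (sym (key-w t<m)))
    ... | inj₂ refl = contradiction iv none
    candidate (jump {j} iv) = inj₂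
      (key-end iv , (λ touched → ℕ.<-irrefl refl (touched-< iv t≤m touched)) ,
       (w (suc t) , key-start iv , descent iv) , above iv ,
       λ k′ (c , o , o′ , iv₁ , iv₂ , o<o′) → o ,
         s≤s⁻¹ (subst (o <_) (unique′ (subst (Iv o′) (position-w (bounded iv)) iv₂) iv) o<o′) ,
         trans (key-start iv₁) (w-position k′))

    -- By `same-block` no interval opened after `t` contains `r` and ends beyond it. Hence the climb
    -- does not pass over `r`, and a path of increasing values leads from `t′` to `r`.
    remaining : ∀ {v} → Remaining t v → w t′ Fin.≤ v
    remaining {v} (¬placed , a , a≤t , eq) = subst (w t′ Fin.≤_) (w-position v) beyond
      where
      r = position v
      t<r = unplaced ¬placed
      a≤m = ℕ.≤-trans a≤t t≤m
      same : last a ≡ last r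
      same = last-≡ a≤m (position≤ v) (trans eq (cong key (sym (w-position v))))
      beyond : w t′ Fin.≤ w r
      beyond with t′ ≤? r
      ... | no t′≰r = contradiction (ℕ.≰⇒> t′≰r)
            (same-block a≤m (position≤ v) same (climb-past c t<r (ℕ.≰⇒> t′≰r)) (s≤s a≤t) t<r)
      ... | yes t′≤r with path t′≤r (position≤ v)
      ...   | inj₁ p = path-w p
      ...   | inj₂ (_ , _ , iv , t′<o , o≤r , r<j) = contradiction r<j
              (same-block a≤m (position≤ v) same iv
                (ℕ.≤-<-trans a≤t (ℕ.<-trans (climb-< c) t′<o)) o≤r)

    -- If the path from t′ did not lead to the position e before the block of k, then the block of k
    -- would cross a block opened between t and e, which is an in-neighbour not yet touched at time t.
    available : ∀ {k} → Available t k → w t′ Fin.≤ k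
    available {k} (k-key , ¬touched , (u , u∈k , u<) , <k , incoming) =
      subst (w t′ Fin.≤_) (w-position k) (go (interval k-key))
      where
      hidden : ∀ {o e} → Iv o (position k) → o ≡ suc e →
               (∃[ o′ ] ∃[ j′ ] Iv o′ j′ × t < o′ × o′ ≤ e × e < j′) → w t′ Fin.≤ w (position k)
      hidden iv refl (o′ , j′ , iv′ , t<o′ , o′≤e , e<j′)
        with o₁ , i , ivi , o′≤o₁ , o₁≤e , arrow ← crossed iv iv′ o′≤e e<j′ =
        contradiction (touched-< ivi t≤m (incoming _ (subst (w i ⟶_) (w-position k) arrow)))
                      (ℕ.<⇒≱ (ℕ.<-≤-trans t<o′ o′≤o₁))

      start-key : ∀ {o} → Iv o (position k) → key (w o) ≡ k
      start-key iv = trans (key-start iv) (w-position k)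

      go : (∃[ o ] Iv o (position k)) → w t′ Fin.≤ w (position k)
      go (o , iv) with suc t ≤? o
      ... | no o≤t = contradiction (o , s≤s⁻¹ (ℕ.≰⇒> o≤t) , start-key iv) ¬touched
      go (suc e , iv) | yes (s≤s t≤e) with ℕ.m≤n⇒m<n∨m≡n t≤e
      -- The block of `k` opens immediately after `t`, so the climb is the jump to `k` itself.
      ... | inj₂ refl = ℕ.≤-reflexive (cong (toℕ ∘ w) (jumps c))
        where
        jumps : ∀ {t′} → Climb t t′ → t′ ≡ position k
        jumps (ascend none _ _) = contradiction iv none
        jumps (jump iv′) = unique iv′ iv
      ... | inj₁ t<e with t′ ≤? e
      ...   | no t′≰e = hidden iv refl
              (suc t , t′ , climb-past c t<e (ℕ.≰⇒> t′≰e) , ℕ.≤-refl , t<e , ℕ.≰⇒> t′≰e)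
      ...   | yes t′≤e with path t′≤e (ℕ.≤-trans (ℕ.≤-trans (ℕ.n≤1+n e) (ordered iv)) (bounded iv))
      ...     | inj₁ p = ℕ.<⇒≤ (ℕ.≤-<-trans (path-w p) (above iv))
      ...     | inj₂ (o′ , j′ , iv′ , t′<o′ , o′≤e , e<j′) =
                hidden iv refl (o′ , j′ , iv′ , ℕ.<-trans (climb-< c) t′<o′ , o′≤e , e<j′)

  -- After either kind of climb `w (suc t)` lies in the block of the target, and by
  -- `block-increasing` it is the least unplaced value there.
  isGreedy : IsGreedy key _⟶_ w m
  isGreedy = record
    { start = trans (key-start sky) w-top , λ {v} eq → subst (w 0 Fin.≤_) (w-position v)
        (block-increasing (position≤ v) z≤n
          (last-≡ z≤n (position≤ v) (trans (key-start sky) (trans w-top (trans (sym eq) (cong key (sym (w-position v))))))))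
    ; step = λ {t} t<m → let t′ , c = climb t<m in
        w t′ , climb-target t<m c ,
        (not-placed (ℕ.n<1+n t) t<m , next-key t<m c) ,
        λ {v} (¬placed , eq) → subst (w (suc t) Fin.≤_) (w-position v)
          (block-increasing (position≤ v) (unplaced ¬placed)
            (last-≡ t<m (position≤ v) (trans (next-key t<m c) (trans (sym eq) (cong key (sym (w-position v)))))))
    }
    where
    next-key : ∀ {t t′} → t < m → Climb t t′ → key (w (suc t)) ≡ key (w t′)
    next-key _ (ascend _ _ _) = refl
    next-key _ (jump iv) = trans (key-start iv) (sym (key-end iv))

-- Running the greedy rule

module Run {m} {key : Value m → Value m} {_⟶_ : Rel (Value m) 0ℓ} (rooted : IsRooted key _⟶_)
           {w : ℕ → Value m} {T} (greedy : IsGreedy key _⟶_ w T) where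
  open IsRooted rooted
  open Greedy key _⟶_ w hiding (IsGreedy)
  open IsGreedy greedy

  touched-mono : ∀ {t t′ k} → t ≤ t′ → Touched t k → Touched t′ k
  touched-mono t≤t′ (s , s≤t , eq) = s , ℕ.≤-trans s≤t t≤t′ , eq

  -- The target is itself an unplaced value of its block, so the next value is at most the target,
  -- which is at most any remaining value.
  next-≤ : ∀ {t v} → t < T → Remaining t v → w (suc t) Fin.≤ v
  next-≤ t<T r with z , (c , z≤) , (_ , y≤) ← step t<T =
    ℕ.≤-trans (y≤ (candidate-unplaced c , refl)) (z≤ (inj₁ r))

  distinct : ∀ {i j} → i < j → j ≤ T → w i ≢ w j
  distinct {i} {suc j} (s≤s i≤j) j<T eq with _ , _ , (¬placed , _) , _ ← step j<T =
    ¬placed (i , i≤j , eq)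

  w-inj : ∀ {i j} → i ≤ T → j ≤ T → w i ≡ w j → i ≡ j
  w-inj {i} {j} i≤T j≤T eq with ℕ.<-cmp i j
  ... | tri< i<j _ _ = contradiction eq (distinct i<j j≤T)
  ... | tri≈ _ i≡j _ = i≡j
  ... | tri> _ _ j<i = contradiction (sym eq) (distinct j<i i≤T)

  -- If the block of `v` was touched before time `t`, then `v` was already a candidate when `w t`
  -- was chosen. If it is touched only at `t`, then `w t` is the least unplaced value of that very
  -- block.
  remaining-> : ∀ {t v} → t ≤ T → Remaining t v → w t Fin.< v
  remaining-> {t} {v} t≤T (¬placed , touched) = <-by-≢ (bound t t≤T ¬placed touched)
      λ eq → ¬placed (t , ℕ.≤-refl , eq)
    where
    bound : ∀ t → t ≤ T → ¬ Placed t v → Touched t (key v) → w t Fin.≤ v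
    bound zero _ _ (zero , _ , eq) = proj₂ start (trans (sym eq) (proj₁ start))
    bound (suc t) t<T ¬placed (s , s≤ , eq) with ℕ.m≤n⇒m<n∨m≡n s≤
    ... | inj₁ (s≤s s≤t) = next-≤ t<T
          ((λ (s , s≤t , eq) → ¬placed (s , ℕ.m≤n⇒m≤1+n s≤t , eq)) , s , s≤t , eq)
    ... | inj₂ refl with _ , _ , (_ , y-key) , y≤ ← step t<T =
          y≤ ((λ (s , s≤t , eq) → ¬placed (s , ℕ.m≤n⇒m≤1+n s≤t , eq)) , trans (sym eq) y-key)

-- The search goes down from `T` and stops where the predecessor fails; for a property that
-- persists, this is the first time it holds.
firstTime : ∀ {P : Pred ℕ 0ℓ} → Decidable P → ∀ {T} → P T →
            ∃[ t ] t ≤ T × P t × (∀ {s} → t ≡ suc s → ¬ P s)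
firstTime P? {zero} p = zero , z≤n , p , λ ()
firstTime P? {suc T} p with P? T
... | no ¬p = suc T , ℕ.≤-refl , p , λ { refl → ¬p }
... | yes p′ with t , t≤T , rest ← firstTime P? p′ = t , ℕ.m≤n⇒m≤1+n t≤T , rest

-- A greedy run that reaches n has placed every value

module Complete {m} {key : Value m → Value m} {_⟶_ : Rel (Value m) 0ℓ} (rooted : IsRooted key _⟶_)
                {w : ℕ → Value m} {T} (greedy : IsGreedy key _⟶_ w T) (top : w T ≡ fromℕ m) where
  open IsRooted rooted
  open Greedy key _⟶_ w hiding (IsGreedy)
  open IsGreedy greedy
  open Run rooted greedy

  -- A remaining value would exceed `w T`, which is the largest value.
  finished : ∀ {v} → Touched T (key v) → Placed T v
  finished {v} touched = Dec.decidable-stable (placed? T v) λ ¬placed →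
    ℕ.<⇒≱ (subst (Fin._< v) top (remaining-> ℕ.≤-refl (¬placed , touched))) (Fin.≤fromℕ v)

  private
    -- As long as k is available, the successive targets stay below k, but w reaches the top.
    trapped : ∀ {k u t₀} → key k ≡ k → key u ≡ k → (∀ k′ → k′ ⟶ k → Touched t₀ k′) → ¬ Touched T k →
              ∀ {s} → s ≤ T → t₀ ≤ s → u Fin.< w s → ¬ w s Fin.< k
    trapped {k} {u} {t₀} k-key u-key incoming ¬touched {s} s≤T t₀≤s = go s≤T t₀≤s (<-wellFounded (T ∸ s))
      where
      go : ∀ {s} → s ≤ T → t₀ ≤ s → Acc _<_ (T ∸ s) → u Fin.< w s → ¬ w s Fin.< k
      go {s} s≤T t₀≤s (acc rec) u< <k
        with s<T ← ℕ.≤∧≢⇒< s≤T (λ { refl → ℕ.<⇒≱ <k (subst (k Fin.≤_) (sym top) (Fin.≤fromℕ k)) })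
        with z , (c , z≤) , ((_ , y-key) , _) ← step s<T
        with s′ , s′≤T , refl ← finished {z} (suc s , s<T , y-key) =
        go s′≤T (ℕ.≤-trans t₀≤s (ℕ.<⇒≤ s<s′)) (rec (ℕ.∸-monoʳ-< s<s′ s′≤T)) (ℕ.<-trans u< (ahead c))
           (<-by-≢ (z≤ (inj₂ available)) λ z≡k →
             ¬touched (suc s , s<T , trans y-key (trans (cong key z≡k) k-key)))
        where
        available : Available s k
        available = k-key , ¬touched ∘ touched-mono s≤T , (u , u-key , u<) , <k ,
                    λ k′ e → touched-mono t₀≤s (incoming k′ e)
        ahead : ∀ {z} → Candidate s z → w s Fin.< z
        ahead (inj₁ r) = remaining-> s≤T r
        ahead (inj₂ (_ , _ , _ , <z , _)) = <z
        s<s′ : s < s′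
        s<s′ = ℕ.≰⇒> λ s′≤s → candidate-unplaced c (s′ , s′≤s , refl)

    -- An alternating quadruple has an element of the first block between two elements of the
    -- second, the larger of which is at most the maximum `k′`.
    inside : ∀ {k k′} → k ⟶ k′ → ∃[ b ] ∃[ u ] key b ≡ k × key u ≡ k′ × u Fin.< b × b Fin.< k′
    inside e with crossing e
    ... | _ , i , j , l , r , _ , l∈ , j∈ , r∈ , inj₁ (_ , j<l , l<r) =
          l , j , l∈ , j∈ , j<l , ℕ.<-≤-trans l<r (subst (r Fin.≤_) r∈ (key-≤ r))
    ... | _ , i , j , l , r , _ , l∈ , j∈ , r∈ , inj₂ (_ , l<j , r<l) =
          l , r , l∈ , r∈ , r<l , ℕ.<-≤-trans l<j (subst (j Fin.≤_) j∈ (key-≤ j))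

    Ready : Value m → Pred ℕ 0ℓ
    Ready k t = ∀ k′ → k′ ⟶ k → Touched t k′

    ready? : ∀ k → Decidable (Ready k)
    ready? k t = all? λ k′ → (k′ ⟶? k) →-dec touched? t k′

    -- By induction along the arrows all in-neighbours of `k` get touched. Let `t₀` be the time when
    -- the last of them, `k′`, is. Its element `b` between `u` and `k` is placed at some `s ≥ t₀`,
    -- and if `k` were never touched, `trapped` would apply from `s` on.
    opened : ∀ k → Acc _⟶_ k → key k ≡ k → Touched T k
    opened k (acc rec) k-key with k ≟ fromℕ m
    ... | yes refl = zero , z≤n , proj₁ start
    ... | no k≢top with t₀ , t₀≤T , incoming , first ← firstTime (ready? k)
                         (λ k′ e → opened k′ (rec e) (crossing-keyˡ (crossing e))) =
      Dec.decidable-stable (touched? T k) λ ¬touched →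
        let k′ , e , fresh = latest t₀ first
            b , u , b∈ , u∈ , u<b , b<k = inside e
            s , s≤T , eq = finished {b} (subst (Touched T) (sym b∈) (touched-mono t₀≤T (incoming k′ e)))
        in trapped k-key u∈ incoming ¬touched s≤T
             (ℕ.≮⇒≥ λ s<t₀ → fresh s<t₀ (trans (cong key eq) b∈))
             (subst (u Fin.<_) (sym eq) u<b) (subst (Fin._< k) (sym eq) b<k)
      where
      latest : ∀ t₀ → (∀ {s} → t₀ ≡ suc s → ¬ Ready k s) →
               ∃[ k′ ] k′ ⟶ k × (∀ {s} → s < t₀ → key (w s) ≢ k′)
      -- At time 0 nothing was placed before, so any in-neighbour is fresh.
      latest zero _ with k′ , e ← parent k-key k≢top = k′ , e , λ ()
      latest (suc t) first with k′ , ¬ok ← Fin.¬∀⟶∃¬ _ _ (λ k′ → (k′ ⟶? k) →-dec touched? t k′) (first refl) =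
        k′ , Dec.decidable-stable (k′ ⟶? k) (λ ¬e → ¬ok λ e → contradiction e ¬e) ,
        λ s< eq → ¬ok λ _ → _ , s≤s⁻¹ s< , eq

  complete : ∀ v → Placed T v
  complete v = finished (opened (key v) (wf (key v)) (key-idem v))

  -- Pigeonhole in both directions: times inject into values because placed values are distinct, and
  -- values inject into times by `complete`.
  T≡m : T ≡ m
  T≡m = ℕ.≤-antisym
    (s≤s⁻¹ (Fin.injective⇒≤ {f = λ (i : Fin (suc T)) → w (toℕ i)} λ {i} {j} eq →
      Fin.toℕ-injective (w-inj (s≤s⁻¹ (Fin.toℕ<n i)) (s≤s⁻¹ (Fin.toℕ<n j)) eq)))
    (s≤s⁻¹ (Fin.injective⇒≤ {f = λ v → Fin.fromℕ< (s≤s (proj₁ (proj₂ (complete v))))} λ {u} {v} eq →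
      trans (sym (proj₂ (proj₂ (complete u))))
        (trans (cong w (Fin.fromℕ<-injective _ _ _ _ eq)) (proj₂ (proj₂ (complete v))))))

-- Existence of a greedy word

module _ {A : Set} (a : A) (next : (ℕ → A) → ℕ → A) where
  private
    -- `prefix t` is the word up to argument `t` and repeats its last entry beyond.
    prefix : ℕ → ℕ → A
    prefix zero    _ = a
    prefix (suc t) s with s ≤? t
    ... | yes _ = prefix t s
    ... | no  _ = next (prefix t) t

    word : ℕ → A
    word t = prefix t t

    prefix-word : ∀ {t s} → s ≤ t → prefix t s ≡ word s
    prefix-word {zero} z≤n = refl
    prefix-word {suc t} {s} s≤ with ℕ.m≤n⇒m<n∨m≡n s≤
    ... | inj₂ refl = refl
    ... | inj₁ (s≤s s≤t) with s ≤? t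
    ...   | yes _ = prefix-word s≤t
    ...   | no s≰t = contradiction s≤t s≰t

    word-suc : ∀ t → word (suc t) ≡ next (prefix t) t
    word-suc t with suc t ≤? t
    ... | yes t<t = contradiction t<t (ℕ.<-irrefl refl)
    ... | no _ = refl

  course-of-values : (P : (ℕ → A) → ℕ → A → Set) →
                     (∀ {f g t y} → (∀ {s} → s ≤ t → f s ≡ g s) → P f t y → P g t y) →
                     (∀ f t → P f t (next f t)) →
                     ∃[ w ] w 0 ≡ a × (∀ t → P w t (w (suc t)))
  course-of-values P resp p = word , refl , λ t →
    subst (P word t) (sym (word-suc t)) (resp prefix-word (p (prefix t) t))

module Termination {m} {key : Value m → Value m} {_⟶_ : Rel (Value m) 0ℓ} (rooted : IsRooted key _⟶_)
                   (w : ℕ → Value m) (start : Least (λ v → key v ≡ fromℕ m) (w 0))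
                   (step : ∀ t → ∃ (Greedy.Remaining key _⟶_ w t) → Greedy.Step key _⟶_ w t (w (suc t))) where
  open IsRooted rooted
  open Greedy key _⟶_ w hiding (IsGreedy)

  private
    -- The block of n is touched at time 0, so until n is placed it is a remaining value and the
    -- hypothesis `step` applies.
    progress : ∀ T → (∃[ T′ ] w T′ ≡ fromℕ m × IsGreedy key _⟶_ w T′) ⊎
                     (¬ Placed T (fromℕ m) × IsGreedy key _⟶_ w T)
    progress zero with w 0 ≟ fromℕ m
    ... | yes top = inj₁ (0 , top , record { start = start ; step = λ () })
    ... | no ¬top = inj₂ ((λ { (_ , z≤n , eq) → ¬top eq }) , record { start = start ; step = λ () })
    progress (suc T) with progress T
    ... | inj₁ done = inj₁ done
    ... | inj₂ (¬placed , greedy) = [ (λ top → inj₁ (suc T , top , extended)) ,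
            (λ ¬top → inj₂ ((λ (s , s≤ , eq) →
              [ (λ s<T → ¬placed (s , s≤s⁻¹ s<T , eq)) , (λ { refl → ¬top eq }) ]′ (ℕ.m≤n⇒m<n∨m≡n s≤)) , extended)) ]′
            (toSum (w (suc T) ≟ fromℕ m))
      where
      extended : IsGreedy key _⟶_ w (suc T)
      extended = record
        { start = start
        ; step = λ t< → [ (λ t<T → IsGreedy.step greedy (s≤s⁻¹ t<T)) ,
            (λ { refl → step T (fromℕ m , ¬placed , 0 , z≤n , trans (proj₁ start) (sym top-key)) })
            ]′ (ℕ.m≤n⇒m<n∨m≡n t<)
        }

  -- A run of length `suc m` without n would place `m + 2` distinct values among `m + 1`.
  reaches-top : ∃[ T ] w T ≡ fromℕ m × IsGreedy key _⟶_ w T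
  reaches-top with progress (suc m)
  ... | inj₁ done = done
  ... | inj₂ (_ , greedy) = contradiction
        (Fin.injective⇒≤ {f = λ (i : Fin (suc (suc m))) → w (toℕ i)} λ {i} {j} eq →
          Fin.toℕ-injective (Run.w-inj rooted greedy (s≤s⁻¹ (Fin.toℕ<n i)) (s≤s⁻¹ (Fin.toℕ<n j)) eq))
        (ℕ.<⇒≱ ℕ.≤-refl)

module _ {m} {key : Value m → Value m} {_⟶_ : Rel (Value m) 0ℓ} (rooted : IsRooted key _⟶_) where
  open IsRooted rooted

  private
    module _ (f : ℕ → Value m) (t : ℕ) where
      open Greedy key _⟶_ f hiding (IsGreedy)

      candidate? : Decidable (Candidate t)
      candidate? v = (¬? (placed? t v) ×-dec touched? t (key v)) ⊎-dec
        ((key v ≟ v) ×-dec ¬? (touched? t v) ×-dec any? (λ u → (key u ≟ v) ×-dec (u Fin.<? f t)) ×-dec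
         (f t Fin.<? v) ×-dec all? (λ k′ → (k′ ⟶? v) →-dec touched? t k′))

      next : ∃[ y ] (∃ (Remaining t) → Step t y)
      next with least? candidate?
      -- A default value: a remaining value would be a candidate.
      ... | inj₂ none = fromℕ m , λ (v , r) → contradiction (inj₁ r) (none v)
      ... | inj₁ (z , c , z≤) with least (λ v → ¬? (placed? t v) ×-dec (key v ≟ key z))
                                       (z , candidate-unplaced c , refl)
      ...   | y , n = y , λ _ → z , (c , z≤) , n

    Step′ : (ℕ → Value m) → ℕ → Value m → Set
    Step′ w t y = ∃ (Greedy.Remaining key _⟶_ w t) → Greedy.Step key _⟶_ w t y

    Step′-resp : ∀ {f g t y} → (∀ {s} → s ≤ t → f s ≡ g s) → Step′ f t y → Step′ g t y
    Step′-resp f≡g p (v , ¬placed , (s , s≤t , eq)) = step-resp f≡g (p (v ,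
      (λ (s , s≤t , eq) → ¬placed (s , s≤t , trans (sym (f≡g s≤t)) eq)) ,
      s , s≤t , trans (cong key (f≡g s≤t)) eq))

    rename-end : ∀ {w T} → T ≡ m → IsGreedy key _⟶_ w T → w T ≡ fromℕ m →
                 ∃[ w ] IsGreedy key _⟶_ w m × w m ≡ fromℕ m
    rename-end refl greedy top = _ , greedy , top

    finish : ∃ (Least (λ v → key v ≡ fromℕ m)) → ∃[ w ] IsGreedy key _⟶_ w m × w m ≡ fromℕ m
    finish (a , least-a) =
      let w , w0≡a , step = course-of-values a (λ f t → proj₁ (next f t)) Step′ Step′-resp
                              (λ f t → proj₂ (next f t))
          T , top , greedy = Termination.reaches-top rooted w (subst (Least _) (sym w0≡a) least-a) step
      in rename-end (Complete.T≡m rooted greedy top) greedy top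

  greedy-exists : ∃[ w ] IsGreedy key _⟶_ w m × w m ≡ fromℕ m
  greedy-exists = finish (least (λ v → key v ≟ fromℕ m) (fromℕ m , top-key))

-- The laminar family of a greedy word

module FromWord {m} {key : Value m → Value m} {_⟶_ : Rel (Value m) 0ℓ} (rooted : IsRooted key _⟶_)
                {w : ℕ → Value m} (greedy : IsGreedy key _⟶_ w m) (top : w m ≡ fromℕ m) where
  open IsRooted rooted
  open Greedy key _⟶_ w hiding (IsGreedy)
  open IsGreedy greedy
  open Run rooted greedy
  open Complete rooted greedy top using (complete)

  private
    pos : Value m → ℕ
    pos v = proj₁ (complete v)

    pos≤ : ∀ v → pos v ≤ m
    pos≤ v = proj₁ (proj₂ (complete v))

    w-pos : ∀ v → w (pos v) ≡ v
    w-pos v = proj₂ (proj₂ (complete v))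

    pos-w : ∀ {l} → l ≤ m → pos (w l) ≡ l
    pos-w l≤m = w-inj (pos≤ _) l≤m (w-pos _)

    unplaced : ∀ {t v} → t < pos v → ¬ Placed t v
    unplaced {t} {v} t<p (s , s≤t , eq) = distinct (ℕ.≤-<-trans s≤t t<p) (pos≤ v) (trans eq (sym (w-pos v)))

    -- As long as `v` is unplaced in a touched block it is a candidate, so every value placed
    -- meanwhile is at most `v`.
    later-≤ : ∀ {t s v} → Touched t (key v) → t < s → s ≤ pos v → w s Fin.≤ v
    later-≤ {s = suc s} {v} touched (s≤s t≤s) s<p =
      next-≤ (ℕ.<-≤-trans s<p (pos≤ v)) (unplaced s<p , touched-mono t≤s touched)

    -- If `v` came first, `u` would be remaining at that moment and therefore larger than `v`.
    pos-mono : ∀ {u v} → key u ≡ key v → u Fin.< v → pos u < pos v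
    pos-mono {u} {v} eq u<v = ℕ.≰⇒> λ pv≤pu →
      let pv<pu = ℕ.≤∧≢⇒< pv≤pu λ p≡ → ℕ.<⇒≢ u<v (cong toℕ
                    (trans (sym (w-pos u)) (trans (cong w (sym p≡)) (w-pos v)))) in
      ℕ.<-asym u<v (subst (Fin._< u) (w-pos v)
        (remaining-> (pos≤ v) (unplaced pv<pu , pos v , ℕ.≤-refl , trans (cong key (w-pos v)) (sym eq))))

    pos-mono-≤ : ∀ {u v} → key u ≡ key v → u Fin.≤ v → pos u ≤ pos v
    pos-mono-≤ {u} {v} eq u≤v with u ≟ v
    ... | yes refl = ℕ.≤-refl
    ... | no u≢v = ℕ.<⇒≤ (pos-mono eq (<-by-≢ u≤v u≢v))

    Descends : ℕ → Set
    Descends d = suc d ≤ m × w (suc d) Fin.< w d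

    -- If the target were a remaining value, the next value would be remaining too and hence larger
    -- than `w d`. So a descent opens an available block, whose maximum is the target.
    pushes : ∀ {d} → Descends d → Target d (key (w (suc d))) × Available d (key (w (suc d)))
    pushes {d} (d<m , y<x) with z , (c , z≤) , ((¬placed , y-key) , y≤) ← step d<m with c
    ... | inj₂ a@(z-key , _) with refl ← trans y-key z-key = (c , z≤) , a
    ... | inj₁ r = contradiction (remaining-> (ℕ.<⇒≤ d<m) (¬placed , subst (Touched d) (sym y-key) (proj₂ r)))
                     (ℕ.<-asym y<x)

    -- The target `k` is at most the candidate `v`. If `v` were placed before `k`, then `later-≤`
    -- would give `v ≤ k`, hence `v ≡ k`, although the block of `k` is untouched at time `d`.
    closes-before : ∀ {d v} → Descends d → Remaining d v → pos (key (w (suc d))) < pos v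
    closes-before {d} {v} desc@(d<m , _) r@(_ , touched) with (c , k≤) , (k-key , ¬touched , _) ← pushes desc =
      ℕ.≰⇒> before
      where
      k = key (w (suc d))
      k≢v : k ≢ v
      k≢v k≡v = ¬touched (subst (Touched d) (trans (cong key (sym k≡v)) k-key) touched)
      d<v : d < pos v
      d<v = ℕ.≰⇒> λ p≤d → proj₁ r (_ , p≤d , w-pos v)
      before : ¬ pos v ≤ pos k
      before v≤k with ℕ.m≤n⇒m<n∨m≡n d<v
      ... | inj₂ eq = ¬touched (subst (Touched d) (trans (cong key (trans (sym (w-pos v)) (cong w (sym eq)))) refl) touched)
      ... | inj₁ d+1<v = k≢v (Fin.≤-antisym (k≤ (inj₁ r)) (subst (Fin._≤ k) (w-pos v)
              (later-≤ (suc d , ℕ.≤-refl , sym k-key) d+1<v v≤k)))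

  data Interval : ℕ → ℕ → Set where
    sky : ∀ {j} → j ≡ m → Interval 0 j
    arc : ∀ {d j} → Descends d → j ≡ pos (key (w (suc d))) → Interval (suc d) j

  private
    end-key : ∀ {o j} → Interval o j → key (w o) ≡ w j
    end-key (sky refl) = trans (proj₁ start) (sym top)
    end-key (arc _ refl) = sym (w-pos _)

    end≤ : ∀ {o j} → Interval o j → j ≤ m
    end≤ (sky refl) = ℕ.≤-refl
    end≤ (arc _ refl) = pos≤ _

    start≤end : ∀ {o j} → Interval o j → o ≤ j
    start≤end (sky _) = z≤n
    start≤end (arc {d} desc refl) = ℕ.≰⇒> λ p≤d →
      candidate-unplaced (proj₁ (proj₁ (pushes desc))) (_ , p≤d , w-pos _)

    remains : ∀ {o l d v} → l ≤ m → d < l → key (w o) ≡ v → key (w l) ≡ v → o ≤ d → Remaining d (w l)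
    remains {o} l≤m d<l refl l∈ o≤d = unplaced (subst (_ <_) (sym (pos-w l≤m)) d<l) , o , o≤d , sym l∈

    end-fixed : ∀ {o j} → Interval o j → key (w j) ≡ w j
    end-fixed iv = trans (cong key (sym (end-key iv))) (trans (key-idem _) (end-key iv))

    -- When the inner interval opens, the maximum `w j` of the outer block is still remaining, and
    -- `closes-before` puts it after the end of the inner one.
    nested : ∀ {o j o′ j′} → Interval o j → Interval o′ j′ → o < o′ → o′ ≤ j → j′ < j
    nested iv (arc desc refl) (s≤s o≤d) d<j = subst (_ <_) (pos-w (end≤ iv))
      (closes-before desc (remains (end≤ iv) d<j (end-key iv) (end-fixed iv) o≤d))

    peaks : ∀ {o j l} → Interval o j → o ≤ l → l < j → w l Fin.< w j
    peaks {o} {j} {l} iv o≤l l<j = <-by-≢ bound (distinct l<j (end≤ iv))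
      where
      bound : w l Fin.≤ w j
      bound with ℕ.m≤n⇒m<n∨m≡n o≤l
      ... | inj₂ refl = subst (w o Fin.≤_) (end-key iv) (key-≤ (w o))
      ... | inj₁ o<l = later-≤ (o , ℕ.≤-refl , trans (end-key iv) (sym (end-fixed iv))) o<l
                         (subst (l ≤_) (sym (pos-w (end≤ iv))) (ℕ.<⇒≤ l<j))

    same-end : ∀ {o j j′} → Interval o j → Interval o j′ → j ≡ j′
    same-end (sky refl) (sky refl) = refl
    same-end (arc _ refl) (arc _ refl) = refl

    -- The least element `u` of a block is placed first. The target at that step cannot be
    -- remaining, since then an earlier element would exist; so the block was available, and one of
    -- its elements lies below `w d`, which makes the step a descent.
    blockInterval : ∀ {u k} → Least (λ u → key u ≡ k) u → Interval (pos u) (pos k)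
    blockInterval {u} {k} (u∈ , u≤) = go (pos u) (pos≤ u) (w-pos u)
      where
      go : ∀ o → o ≤ m → w o ≡ u → Interval o (pos k)
      go zero _ eq = sky (trans (cong pos (trans (sym u∈) (trans (cong key (sym eq)) (trans (proj₁ start) (sym top)))))
                            (pos-w ℕ.≤-refl))
      go (suc d) d<m eq with z , (c , _) , ((_ , y-key) , _) ← step d<m = arc (d<m , opens c) (cong pos (sym k≡))
        where
        k≡ : key (w (suc d)) ≡ k
        k≡ = trans (cong key eq) u∈
        opens : Candidate d z → w (suc d) Fin.< w d
        opens (inj₂ (z-key , _ , (b , b∈ , b<) , _)) = ℕ.≤-<-trans
          (subst (Fin._≤ b) (sym eq) (u≤ (trans b∈ (trans (sym z-key) (trans (sym y-key) k≡))))) b<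
        opens (inj₁ (_ , s , s≤d , s∈)) = contradiction
          (ℕ.≤-trans (subst₂ _≤_ (trans (cong pos (sym eq)) (pos-w d<m)) (pos-w (ℕ.≤-trans s≤d (ℕ.<⇒≤ d<m)))
             (pos-mono-≤ (trans u∈ (sym ws∈)) (u≤ ws∈))) s≤d) (ℕ.<-irrefl refl)
          where
          ws∈ : key (w s) ≡ k
          ws∈ = trans s∈ (trans (sym y-key) k≡)

  intervals : Intervals w Interval
  intervals = record
    { w-injective = w-inj
    ; position    = pos
    ; position≤   = pos≤
    ; w-position  = w-pos
    ; w-top       = top
    ; sky         = sky refl
    ; ordered     = start≤end
    ; bounded     = end≤
    ; unique      = same-end
    ; laminar     = nested
    ; peak        = peaks
    ; descent     = λ { (arc (_ , y<x) _) → y<x }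
    ; above       = λ { (arc desc refl) → let _ , _ , _ , _ , <k , _ = pushes desc in
                        subst (_ Fin.<_) (sym (w-pos _)) <k }
    ; ascent      = ascents
    ; last        = λ l → pos (key (w l))
    ; innermost   = inner
    }
    where
    ascents : ∀ {s} → s < m → (∃[ j ] Interval (suc s) j) ⊎
                              ((∀ {j} → ¬ Interval (suc s) j) × w s Fin.< w (suc s))
    ascents {s} s<m with Fin.<-cmp (w (suc s)) (w s)
    ... | tri< y<x _ _ = inj₁ (_ , arc (s<m , y<x) refl)
    ... | tri≈ _ eq _ = contradiction (sym eq) (distinct (ℕ.n<1+n s) s<m)
    ... | tri> ¬y<x _ x<y = inj₂ ((λ { (arc (_ , y<x) _) → ¬y<x y<x }) , x<y)

    inner : ∀ {l} → l ≤ m → ∃[ o ] Interval o (pos (key (w l))) × o ≤ l × l ≤ pos (key (w l)) ×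
            (∀ {o′ j′} → Interval o′ j′ → o < o′ → o′ ≤ l → j′ < l)
    inner {l} l≤m with u , lu@(u∈ , u≤) ← least (λ u → key u ≟ key (w l)) (w l , refl) =
      pos u , blockInterval lu ,
      subst (pos u ≤_) (pos-w l≤m) (pos-mono-≤ u∈ (u≤ refl)) ,
      subst (_≤ pos (key (w l))) (pos-w l≤m) (pos-mono-≤ (sym (key-idem _)) (key-≤ _)) ,
      λ { (arc desc refl) (s≤s o≤d) d<l → subst (_ <_) (pos-w l≤m)
            (closes-before desc (remains l≤m d<l (trans (cong key (w-pos u)) u∈) refl o≤d)) }

  open Intervals intervals using (interval; last-≥start; w-position; position≤) renaming (key to key′; _⟶_ to _⟶′_; isRooted to rooted′)

  key-agrees : key′ ≗ key
  key-agrees v = trans (w-pos _) (cong key (w-pos v))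

  -- Both relations orient the same crossing graph, so by asymmetry one inclusion suffices. It holds
  -- because the rule opens a block only after all of its in-neighbours.
  arrow-agrees : ∀ k k′ → (k ⟶′ k′) ⇔ (k ⟶ k′)
  arrow-agrees k k′ = mk⇔
    (λ e → [ id , (λ e′ → contradiction (forward e′) (wf⇒asym (IsRooted.wf rooted′) e)) ]′
             (orient (CrossingKeys-resp key-agrees (proj₁ e))))
    forward
    where
    forward : ∀ {k k′} → k ⟶ k′ → k ⟶′ k′
    forward {k} {k′} e
      with o , iv ← interval {k} (trans (key-agrees k) (crossing-keyˡ (crossing e)))
         | o′ , iv′ ← interval {k′} (trans (key-agrees k′) (crossing-keyʳ (crossing e))) =
      CrossingKeys-resp (sym ∘ key-agrees) (crossing e) , o , o′ , iv , iv′ , earlier iv′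
      where
      earlier : ∀ {o′} → Interval o′ (pos k′) → o < o′
      earlier (sky eq) = contradiction
        (subst (k ⟶_) (trans (sym (w-pos k′)) (trans (cong w eq) top)) e) root
      earlier (arc {d} desc eq) with _ , (_ , _ , _ , _ , incoming) ← pushes desc
        with s , s≤d , s∈ ← incoming k (subst (k ⟶_) (trans (sym (w-pos k′)) (trans (cong w eq) (w-pos _))) e) =
        s≤s (ℕ.≤-trans (last-≥start iv (ℕ.≤-trans s≤d (ℕ.<⇒≤ (proj₁ desc))) (cong pos s∈)) s≤d)

-- Valid hook configurations as interval families

lookup-∈ : ∀ {A : Set} {P : Pred A 0ℓ} {xs} (p : Any P xs) → Any.lookup p List.∈ xs
lookup-∈ (here _) = here refl
lookup-∈ (there p) = there (lookup-∈ p)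

map-injective-local : ∀ {A B : Set} (f : A → B) {xs ys : List A} → map f xs ≡ map f ys →
                      (∀ {x y} → x List.∈ xs → y List.∈ ys → f x ≡ f y → x ≡ y) → xs ≡ ys
map-injective-local f {[]} {[]} _ _ = refl
map-injective-local f {x ∷ xs} {y ∷ ys} eq inj = cong₂ _∷_
  (inj (here refl) (here refl) (∷-injectiveˡ eq))
  (map-injective-local f (∷-injectiveʳ eq) λ x∈ y∈ → inj (there x∈) (there y∈))

real : ∀ {m l} → l < m → ∃[ i ] toℕ {m} i ≡ l
real l<m = fromℕ< l<m , Fin.toℕ-fromℕ< l<m

module _ {m} {w w′ : ℕ → Value m} {Iv Iv′ : ℕ → ℕ → Set} (I : Intervals w Iv) (I′ : Intervals w′ Iv′)
         (w≡ : ∀ {l} → l ≤ m → w l ≡ w′ l) (Iv⇔ : ∀ {o j} → Iv o j ⇔ Iv′ o j) where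
  private
    module I = Intervals I
    module I′ = Intervals I′

    position≡ : ∀ v → I.position v ≡ I′.position v
    position≡ v = I′.w-injective (I.position≤ v) (I′.position≤ v)
      (trans (sym (w≡ (I.position≤ v))) (trans (I.w-position v) (sym (I′.w-position v))))

    last≡ : ∀ {l} → l ≤ m → I.last l ≡ I′.last l
    last≡ l≤m with o , iv , o≤l , l≤j , inner ← I′.innermost l≤m =
      I.last-unique (from Iv⇔ iv) o≤l l≤j (λ iv → inner (to Iv⇔ iv))

  -- The functions `position` and `last` are determined by the word and its intervals.
  same-key : I.key ≗ I′.key
  same-key v = trans (w≡ (I.last≤m (I.position≤ v)))
    (cong w′ (trans (last≡ (I.position≤ v)) (cong I′.last (position≡ v))))

  same-arrow : ∀ {k k′} → k I.⟶ k′ → k I′.⟶ k′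
  same-arrow {k} {k′} (c , o , o′ , iv , iv′ , o<o′) =
    CrossingKeys-resp same-key c , o , o′ ,
    subst (Iv′ o) (position≡ k) (to Iv⇔ iv) , subst (Iv′ o′) (position≡ k′) (to Iv⇔ iv′) , o<o′

module FromVHC {m} (H : VHC m) where
  open VHC H renaming (perm to π)
  open IsVHC isVHC

  -- The permutation followed by n at position `m`; only arguments up to `m` matter.
  w : ℕ → Value m
  w l with l <? m
  ... | yes l<m = inject₁ (π ⟨$⟩ʳ fromℕ< l<m)
  ... | no _ = fromℕ m

  w-toℕ : ∀ i → w (toℕ i) ≡ inject₁ (π ⟨$⟩ʳ i)
  w-toℕ i with toℕ i <? m
  ... | yes p = cong (λ i → inject₁ (π ⟨$⟩ʳ i)) (Fin.fromℕ<-toℕ i p)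
  ... | no i≮m = contradiction (Fin.toℕ<n i) i≮m

  w-m : w m ≡ fromℕ m
  w-m with m <? m
  ... | yes m<m = contradiction m<m (ℕ.<-irrefl refl)
  ... | no _ = refl

  data Interval (o j : ℕ) : Set where
    sky : o ≡ 0 → j ≡ m → Interval o j
    arc : ∀ {h} → h List.∈ hooks → o ≡ suc (toℕ (sw h)) → j ≡ toℕ (ne h) → Interval o j

  position : Value m → ℕ
  position v with view v
  ... | ‵fromℕ = m
  ... | ‵inject₁ u = toℕ (π ⟨$⟩ˡ u)

  end : Colour m → ℕ
  end blue = m
  end (ofHook h) = toℕ (ne h)

  last : ℕ → ℕ
  last l with l <? m
  ... | yes l<m = end (pointColour H (fromℕ< l<m))
  ... | no _ = m

  private
    π-injective : ∀ {i j} → π ⟨$⟩ʳ i ≡ π ⟨$⟩ʳ j → i ≡ j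
    π-injective eq = trans (sym (inverseˡ π)) (trans (cong (π ⟨$⟩ˡ_) eq) (inverseˡ π))

    w-< : ∀ {i j} → π ⟨$⟩ʳ i Fin.< π ⟨$⟩ʳ j → w (toℕ i) Fin.< w (toℕ j)
    w-< {i} {j} = subst₂ _<_
      (sym (trans (cong toℕ (w-toℕ i)) (Fin.toℕ-inject₁ _)))
      (sym (trans (cong toℕ (w-toℕ j)) (Fin.toℕ-inject₁ _)))

    w-<m : ∀ i → w (toℕ i) Fin.< w m
    w-<m i = subst₂ Fin._<_ (sym (w-toℕ i)) (sym w-m)
      (subst (toℕ (inject₁ (π ⟨$⟩ʳ i)) <_) (sym (Fin.toℕ-fromℕ m)) (Fin.inject₁ℕ< _))

    w-injective : ∀ {i j} → i ≤ m → j ≤ m → w i ≡ w j → i ≡ j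
    w-injective i≤m j≤m eq with ℕ.m≤n⇒m<n∨m≡n i≤m | ℕ.m≤n⇒m<n∨m≡n j≤m
    ... | inj₂ refl | inj₂ refl = refl
    ... | inj₂ refl | inj₁ j<m with j , refl ← real j<m =
          contradiction (w-<m j) (ℕ.<-irrefl (cong toℕ (sym eq)))
    w-injective i≤m j≤m eq | inj₁ i<m | inj₂ refl with i , refl ← real i<m =
          contradiction (w-<m i) (ℕ.<-irrefl (cong toℕ eq))
    w-injective i≤m j≤m eq | inj₁ i<m | inj₁ j<m with i , refl ← real i<m | j , refl ← real j<m =
          cong toℕ (π-injective (Fin.inject₁-injective (trans (sym (w-toℕ i)) (trans eq (w-toℕ j)))))

    position≤ : ∀ v → position v ≤ m
    position≤ v with view v
    ... | ‵fromℕ = ℕ.≤-refl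
    ... | ‵inject₁ u = ℕ.<⇒≤ (Fin.toℕ<n _)

    w-position : ∀ v → w (position v) ≡ v
    w-position v with view v
    ... | ‵fromℕ = w-m
    ... | ‵inject₁ u = trans (w-toℕ _) (cong inject₁ (inverseʳ π))

    _≟ʰ_ : (h h′ : Hook m) → Dec (h ≡ h′)
    hook i j ≟ʰ hook i′ j′ with i ≟ i′ | j ≟ j′
    ... | yes refl | yes refl = yes refl
    ... | no i≢i′ | _ = no λ { refl → i≢i′ refl }
    ... | yes _ | no j≢j′ = no λ { refl → j≢j′ refl }

    -- Distinct hooks starting at one point meet there, which would have to be the northeast
    -- endpoint of one of them.
    sw-unique : ∀ {h h′} → h List.∈ hooks → h′ List.∈ hooks → sw h ≡ sw h′ → h ≡ h′
    sw-unique {h} {h′} h∈ h′∈ refl = Dec.decidable-stable (h ≟ʰ h′) λ h≢h′ →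
      [ (λ ((sw≡ne , _) , _) → ℕ.<-irrefl (cong toℕ sw≡ne) (proj₁ (isHook h∈))) ,
        (λ (_ , (sw≡ne , _)) → ℕ.<-irrefl (cong toℕ sw≡ne) (proj₁ (isHook h′∈))) ]′
      (nonIntersecting h∈ h′∈ h≢h′ (sw h) (π ⟨$⟩ʳ sw h)
        (inj₁ (refl , ℕ.≤-refl , ℕ.<⇒≤ (proj₂ (isHook h∈))))
        (inj₁ (refl , ℕ.≤-refl , ℕ.<⇒≤ (proj₂ (isHook h′∈)))))

    ne-unique : ∀ {h h′} → h List.∈ hooks → h′ List.∈ hooks → ne h ≡ ne h′ → h ≡ h′
    ne-unique {h} {h′} h∈ h′∈ refl = Dec.decidable-stable (h ≟ʰ h′) λ h≢h′ →
      [ (λ (_ , (ne≡sw , _)) → ℕ.<-irrefl (cong toℕ (sym ne≡sw)) (proj₁ (isHook h′∈))) ,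
        (λ ((ne≡sw , _) , _) → ℕ.<-irrefl (cong toℕ (sym ne≡sw)) (proj₁ (isHook h∈))) ]′
      (nonIntersecting h∈ h′∈ h≢h′ (ne h) (π ⟨$⟩ʳ ne h)
        (inj₂ (ℕ.<⇒≤ (proj₁ (isHook h∈)) , ℕ.≤-refl , refl))
        (inj₂ (ℕ.<⇒≤ (proj₁ (isHook h′∈)) , ℕ.≤-refl , refl)))

    -- If `h′` ended beyond `ne h`, its vertical part would meet the horizontal part of `h` at
    -- `(sw h′ , π (ne h))`, a forbidden point; `noPointAbove` for `h` and for `h′` gives the bounds
    -- on the height.
    nested : ∀ {h h′} → h List.∈ hooks → h′ List.∈ hooks → sw h Fin.< sw h′ → sw h′ Fin.< ne h → ne h′ Fin.< ne h
    nested {h} {h′} h∈ h′∈ d<d′ d′<j with Fin.<-cmp (ne h′) (ne h)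
    ... | tri< j′<j _ _ = j′<j
    ... | tri≈ _ eq _ = contradiction d<d′ (ℕ.<-irrefl (cong (toℕ ∘ sw) (ne-unique h∈ h′∈ (sym eq))))
    ... | tri> _ _ j<j′ = contradiction
          (nonIntersecting h∈ h′∈ (λ { refl → ℕ.<-irrefl refl d<d′ }) (sw h′) (π ⟨$⟩ʳ ne h)
            (inj₂ (ℕ.<⇒≤ d<d′ , ℕ.<⇒≤ d′<j , refl))
            (inj₁ (refl , ℕ.<⇒≤ (noPointAbove h∈ _ d<d′ d′<j) , ℕ.<⇒≤ (noPointAbove h′∈ _ d′<j j<j′))))
          [ (λ ((d′≡j , _) , _) → ℕ.<-irrefl (cong toℕ d′≡j) d′<j) ,
            (λ ((d′≡d , _) , _) → ℕ.<-irrefl (cong toℕ (sym d′≡d)) d<d′) ]′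

    descending : ∀ {h} → h List.∈ hooks → Descent π (sw h)
    descending h∈ = proj₂ (∈-filter⁻ (descent? π) {xs = allFin m} (subst (_ List.∈_) southwest (∈-map⁺ sw h∈)))

    hookAt : ∀ {i} → Descent π i → ∃[ h ] h List.∈ hooks × sw h ≡ i
    hookAt {i} d with h , h∈ , eq ← ∈-map⁻ sw (subst (i List.∈_) (sym southwest) (∈-filter⁺ (descent? π) (∈-allFin i) d)) =
      h , h∈ , sym eq

  -- The colouring rule as a property: a northeast endpoint, a point that sees a lowest hook, or a
  -- point that sees the sky. What follows relies on this instead of the computation of
  -- `pointColour`.
  Spec : Fin m → Colour m → Set
  Spec l c =
      (∃[ h ] h List.∈ hooks × c ≡ ofHook h × ne h ≡ l)
    ⊎ (∀ {h} → h List.∈ hooks → ne h ≢ l) ×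
      ( (∃[ h ] h List.∈ hooks × c ≡ ofHook h × sw h Fin.< l × l Fin.< ne h ×
           (∀ {h′} → h′ List.∈ hooks → sw h′ Fin.< l → l Fin.< ne h′ → π ⟨$⟩ʳ ne h Fin.≤ π ⟨$⟩ʳ ne h′))
      ⊎ (c ≡ blue × (∀ {h} → h List.∈ hooks → sw h Fin.< l → ¬ l Fin.< ne h)))

  lookUp-spec : ∀ l →
      (∃[ h ] h List.∈ hooks × lookUp H l ≡ ofHook h × sw h Fin.< l × l Fin.< ne h ×
           (∀ {h′} → h′ List.∈ hooks → sw h′ Fin.< l → l Fin.< ne h′ → π ⟨$⟩ʳ ne h Fin.≤ π ⟨$⟩ʳ ne h′))
      ⊎ (lookUp H l ≡ blue × (∀ {h} → h List.∈ hooks → sw h Fin.< l → ¬ l Fin.< ne h))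
  lookUp-spec l = [ inj₂ ∘ seesSky , inj₁ ∘ seesHook ]′ (argmin-sel (height H) blue above)
    where
    over? : Decidable (λ h → sw h Fin.< l × l Fin.< ne h)
    over? h = (sw h Fin.<? l) ×-dec (l Fin.<? ne h)

    above : List (Colour m)
    above = map ofHook (filter over? hooks)

    minimal : ∀ {h} → h List.∈ hooks → sw h Fin.< l → l Fin.< ne h →
              height H (lookUp H l) ≤ toℕ (π ⟨$⟩ʳ ne h)
    minimal h∈ d<l l<j = All.lookup (f[argmin]≤f[xs] {f = height H} blue above)
      (∈-map⁺ ofHook (∈-filter⁺ over? h∈ (d<l , l<j)))

    seesSky : lookUp H l ≡ blue → lookUp H l ≡ blue × (∀ {h} → h List.∈ hooks → sw h Fin.< l → ¬ l Fin.< ne h)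
    -- The sky has height `m`, above every hook, so it is selected only when no hook is overhead.
    seesSky eq = eq , λ h∈ d<l l<j → ℕ.<⇒≱ (Fin.toℕ<n _)
      (subst (λ c → height H c ≤ _) eq (minimal h∈ d<l l<j))

    seesHook : lookUp H l List.∈ above →
      ∃[ h ] h List.∈ hooks × lookUp H l ≡ ofHook h × sw h Fin.< l × l Fin.< ne h ×
           (∀ {h′} → h′ List.∈ hooks → sw h′ Fin.< l → l Fin.< ne h′ → π ⟨$⟩ʳ ne h Fin.≤ π ⟨$⟩ʳ ne h′)
    seesHook c∈ =
      let h , h∈f , eq = ∈-map⁻ ofHook c∈
          h∈ , d<l , l<j = ∈-filter⁻ over? {xs = hooks} h∈f
      in h , h∈ , eq , d<l , l<j , λ h′∈ d′<l l<j′ →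
           subst (λ c → height H c ≤ _) eq (minimal h′∈ d′<l l<j′)

  pointColour-spec : ∀ l → Spec l (pointColour H l)
  pointColour-spec l with Any.any? (λ h → ne h ≟ l) hooks
  ... | yes l∈ne = inj₁ (Any.lookup l∈ne , lookup-∈ l∈ne , refl , Any.lookup-result l∈ne)
  ... | no l∉ne = inj₂ ((λ h∈ eq → l∉ne (List.lose h∈ eq)) , lookUp-spec l)

  last-toℕ : ∀ i → last (toℕ i) ≡ end (pointColour H i)
  last-toℕ i with toℕ i <? m
  ... | yes p = cong (end ∘ pointColour H) (Fin.fromℕ<-toℕ i p)
  ... | no i≮m = contradiction (Fin.toℕ<n i) i≮m

  last-m : last m ≡ m
  last-m with m <? m
  ... | yes m<m = contradiction m<m (ℕ.<-irrefl refl)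
  ... | no _ = refl

  private
    laminar : ∀ {o j o′ j′} → Interval o j → Interval o′ j′ → o < o′ → o′ ≤ j → j′ < j
    laminar (sky refl refl) (sky refl _) () _
    laminar (sky refl refl) (arc _ _ refl) _ _ = Fin.toℕ<n _
    laminar (arc _ refl refl) (sky refl _) () _
    laminar (arc h∈ refl refl) (arc h′∈ refl refl) d<d′ d′<j = nested h∈ h′∈ (s≤s⁻¹ d<d′) d′<j

    Inner : ℕ → ℕ → Set
    Inner l j = ∃[ o ] Interval o j × o ≤ l × l ≤ j × (∀ {o′ j′} → Interval o′ j′ → o < o′ → o′ ≤ l → j′ < l)

    -- The lowest hook over a point is the innermost one: a hook opened later that still covers the
    -- point is nested, so by `noPointAbove` it would be lower.
    inner-spec : ∀ l c → Spec l c → Inner (toℕ l) (end c)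
    inner-spec l _ (inj₁ (h , h∈ , refl , refl)) =
      suc (toℕ (sw h)) , arc h∈ refl refl , proj₁ (isHook h∈) , ℕ.≤-refl , laminar (arc h∈ refl refl)
    inner-spec l _ (inj₂ (l∉ne , inj₁ (h , h∈ , refl , d<l , l<j , least))) =
      suc (toℕ (sw h)) , arc h∈ refl refl , d<l , ℕ.<⇒≤ l<j , inner
      where
      inner : ∀ {o′ j′} → Interval o′ j′ → suc (toℕ (sw h)) < o′ → o′ ≤ toℕ l → j′ < toℕ l
      inner (sky refl _) () _
      inner (arc {h′} h′∈ refl refl) d<d′ d′<l with Fin.<-cmp (ne h′) l
      ... | tri< j′<l _ _ = j′<l
      ... | tri≈ _ eq _ = contradiction eq (l∉ne h′∈)
      ... | tri> _ _ l<j′ = contradiction (least h′∈ d′<l l<j′)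
            (ℕ.<⇒≱ (noPointAbove h∈ _ (ℕ.<-trans d<l l<j′) (nested h∈ h′∈ (s≤s⁻¹ d<d′) (ℕ.<-trans d′<l l<j))))
    inner-spec l _ (inj₂ (l∉ne , inj₂ (refl , none))) =
      0 , sky refl refl , z≤n , ℕ.<⇒≤ (Fin.toℕ<n l) , inner
      where
      inner : ∀ {o′ j′} → Interval o′ j′ → 0 < o′ → o′ ≤ toℕ l → j′ < toℕ l
      inner (sky refl _) () _
      inner (arc {h′} h′∈ refl refl) _ d′<l with Fin.<-cmp (ne h′) l
      ... | tri< j′<l _ _ = j′<l
      ... | tri≈ _ eq _ = contradiction eq (l∉ne h′∈)
      ... | tri> _ _ l<j′ = contradiction l<j′ (none h′∈ d′<l)

    innermost : ∀ {l} → l ≤ m → Inner l (last l)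
    innermost l≤m with ℕ.m≤n⇒m<n∨m≡n l≤m
    ... | inj₁ l<m with i , refl ← real l<m =
          subst (Inner (toℕ i)) (sym (last-toℕ i)) (inner-spec i (pointColour H i) (pointColour-spec i))
    innermost l≤m | inj₂ refl = subst (Inner m) (sym last-m)
          (0 , sky refl refl , z≤n , ℕ.≤-refl , λ { (sky refl _) () _ ; (arc _ _ refl) _ _ → Fin.toℕ<n _ })

    peak : ∀ {o j l} → Interval o j → o ≤ l → l < j → w l Fin.< w j
    peak (sky refl refl) _ l<m with i , refl ← real l<m = w-<m i
    peak (arc {h} h∈ refl refl) d<l l<j with i , refl ← real (ℕ.<-trans l<j (Fin.toℕ<n (ne h))) =
      w-< (noPointAbove h∈ i d<l l<j)

    ascent : ∀ {s} → s < m → (∃[ j ] Interval (suc s) j) ⊎ ((∀ {j} → ¬ Interval (suc s) j) × w s Fin.< w (suc s))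
    ascent s<m with i , refl ← real s<m with descent? π i
    ... | yes d with h , h∈ , refl ← hookAt d = inj₁ (_ , arc h∈ refl refl)
    ... | no ¬d = inj₂
          ( (λ { (arc h∈ eq _) → ¬d (subst (Descent π) (Fin.toℕ-injective (sym (ℕ.suc-injective eq))) (descending h∈)) })
          , rise (ℕ.m≤n⇒m<n∨m≡n s<m))
      where
      rise : suc (toℕ i) < m ⊎ suc (toℕ i) ≡ m → w (toℕ i) Fin.< w (suc (toℕ i))
      -- The last index is followed by n at position `m`, so it counts as an ascent.
      rise (inj₂ eq) = subst (λ j → w (toℕ i) Fin.< w j) (sym eq) (w-<m i)
      rise (inj₁ i+1<m) with j , eq ← real i+1<m with Fin.<-cmp (π ⟨$⟩ʳ i) (π ⟨$⟩ʳ j)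
      ... | tri< lt _ _ = subst (λ j → w (toℕ i) Fin.< w j) eq (w-< lt)
      ... | tri≈ _ same _ = contradiction (trans (cong toℕ (π-injective same)) eq) (ℕ.<⇒≢ (ℕ.n<1+n _))
      ... | tri> _ _ gt = contradiction (j , eq , gt) ¬d

    descent : ∀ {d j} → Interval (suc d) j → w (suc d) Fin.< w d
    descent (arc h∈ refl _) with j , eq , lt ← descending h∈ = subst (λ j → w j Fin.< _) eq (w-< lt)

  intervals : Intervals w Interval
  intervals = record
    { w-injective = w-injective
    ; position    = position
    ; position≤   = position≤
    ; w-position  = w-position
    ; w-top       = w-m
    ; sky         = sky refl refl
    ; ordered     = λ { (sky refl _) → z≤n ; (arc h∈ refl refl) → proj₁ (isHook h∈) }
    ; bounded     = λ { (sky _ refl) → ℕ.≤-refl ; (arc _ _ refl) → ℕ.<⇒≤ (Fin.toℕ<n _) }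
    ; unique      = unique
    ; laminar     = laminar
    ; peak        = peak
    ; descent     = descent
    ; above       = λ { (arc h∈ refl refl) → w-< (proj₂ (isHook h∈)) }
    ; ascent      = ascent
    ; last        = last
    ; innermost   = innermost
    }
    where
    unique : ∀ {o j j′} → Interval o j → Interval o j′ → j ≡ j′
    unique (sky _ refl) (sky _ refl) = refl
    unique (sky refl _) (arc _ () _)
    unique (arc _ refl _) (sky () _)
    unique (arc h∈ refl refl) (arc h′∈ eq refl) =
      cong (toℕ ∘ ne) (sw-unique h∈ h′∈ (Fin.toℕ-injective (ℕ.suc-injective eq)))

  private module I = Intervals intervals
  open I using (key; key-w; key-start; last-≥start; interval; position-key; _⟶_)

  private
    Valid : Colour m → Set
    Valid c = c ≡ blue ⊎ (∃[ h ] h List.∈ hooks × c ≡ ofHook h)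

    valid-spec : ∀ {l c} → Spec l c → Valid c
    valid-spec (inj₁ (h , h∈ , eq , _)) = inj₂ (h , h∈ , eq)
    valid-spec (inj₂ (_ , inj₁ (h , h∈ , eq , _))) = inj₂ (h , h∈ , eq)
    valid-spec (inj₂ (_ , inj₂ (eq , _))) = inj₁ eq

    valid : ∀ v → Valid (colour H v)
    valid v with view v
    ... | ‵fromℕ = inj₁ refl
    ... | ‵inject₁ u = valid-spec (pointColour-spec _)

    last-position : ∀ v → last (position v) ≡ end (colour H v)
    last-position v with view v
    ... | ‵fromℕ = last-m
    ... | ‵inject₁ u = last-toℕ _

    -- Hooks of the configuration are told apart by their northeast endpoints, all of which lie
    -- before position `m`, the end of the sky.
    end-injective : ∀ {c c′} → Valid c → Valid c′ → end c ≡ end c′ → c ≡ c′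
    end-injective (inj₁ refl) (inj₁ refl) _ = refl
    end-injective (inj₁ refl) (inj₂ (h , _ , refl)) eq = contradiction (Fin.toℕ<n (ne h)) (ℕ.<-irrefl (sym eq))
    end-injective (inj₂ (h , _ , refl)) (inj₁ refl) eq = contradiction (Fin.toℕ<n (ne h)) (ℕ.<-irrefl eq)
    end-injective (inj₂ (h , h∈ , refl)) (inj₂ (h′ , h′∈ , refl)) eq =
      cong ofHook (ne-unique h∈ h′∈ (Fin.toℕ-injective eq))

    colour⇔key : ∀ u v → colour H u ≡ colour H v ⇔ key u ≡ key v
    colour⇔key u v = mk⇔
      (λ eq → cong w (trans (last-position u) (trans (cong end eq) (sym (last-position v)))))
      (λ eq → end-injective (valid u) (valid v) (trans (sym (last-position u))
        (trans (w-injective (I.last≤m (position≤ u)) (I.last≤m (position≤ v)) eq) (last-position v))))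

    class⇔block : ∀ B v → (∀ u → u ∈ B ⇔ colour H u ≡ colour H v) ⇔ IsBlock key B (key v)
    class⇔block B v = mk⇔
      (λ c u → mk⇔ (to (colour⇔key u v) ∘ to (c u)) (from (c u) ∘ from (colour⇔key u v)))
      (λ b u → mk⇔ (from (colour⇔key u v) ∘ to (b u)) (from (b u) ∘ to (colour⇔key u v)))

    hat-≥ : ∀ {B k o} → IsBlock key B k → Interval o (position k) → ∀ {i} → Hat H B i → o ≤ toℕ i
    hat-≥ {B} b iv {i} i∈ = last-≥start iv i≤m
      (sym (position-key i≤m (to (b _) (subst (_∈ B) (sym (w-toℕ i)) i∈))))
      where i≤m = ℕ.<⇒≤ (Fin.toℕ<n i)

    -- The first position of a block is where its interval opens, which ties the minima of hats to
    -- the order of openings.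
    hat-start : ∀ {B k} → IsBlock key B k → ∀ {i} → Interval (toℕ i) (position k) → Least (Hat H B) i
    hat-start {B} {k} b {i} iv =
      subst (_∈ B) (w-toℕ i) (from (b _) (trans (key-start iv) (w-position k))) , hat-≥ b iv

    starts : ∀ {k k′ B B′} → IsBlock key B k → IsBlock key B′ k′ →
             (∃[ o ] ∃[ o′ ] Interval o (position k) × Interval o′ (position k′) × o < o′) →
             ∃[ i ] ∃[ j ] Least (Hat H B) i × Least (Hat H B′) j × i Fin.< j
    starts b b′ (o , o′ , iv , iv′ , o<o′)
      -- The later interval lies strictly inside the sky, so both openings are indices of the
      -- permutation.
      with o′<m ← ℕ.≤-<-trans (I.ordered iv′) (laminar (sky refl refl) iv′ (ℕ.≤-<-trans z≤n o<o′)
                                 (ℕ.≤-trans (I.ordered iv′) (I.bounded iv′)))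
      with i , refl ← real (ℕ.<-trans o<o′ o′<m) | j , refl ← real o′<m =
      i , j , hat-start b iv , hat-start b′ iv′ , o<o′

    starts⁻ : ∀ {k k′ B B′} → key k ≡ k → key k′ ≡ k′ → IsBlock key B k → IsBlock key B′ k′ →
              ∃[ i ] ∃[ j ] Least (Hat H B) i × Least (Hat H B′) j × i Fin.< j →
              ∃[ o ] ∃[ o′ ] Interval o (position k) × Interval o′ (position k′) × o < o′
    starts⁻ k-key k′-key b b′ (i , j , (i∈ , _) , (j∈ , j≤) , i<j)
      with o , iv ← interval k-key | o′ , iv′ ← interval k′-key
      with j′ , refl ← real (ℕ.≤-<-trans (hat-≥ b′ iv′ j∈) (Fin.toℕ<n j)) =
      o , toℕ j′ , iv , iv′ , ℕ.≤-<-trans (hat-≥ b iv i∈) (ℕ.<-≤-trans i<j (j≤ (proj₁ (hat-start b′ iv′))))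

  isRooted : IsRooted key _⟶_
  isRooted = I.isRooted

  represents : Represents (Φ H) key _⟶_
  represents = record
    { family⇔ = family⇔
    ; arrow⇔ = λ B B′ → mk⇔
        (λ ((B∈ , B′∈ , c) , least) →
          let k , k-key , b = to (family⇔ B) B∈ ; k′ , k′-key , b′ = to (family⇔ B′) B′∈ in
          k , k′ , b , b′ , crossing-keys key b b′ c , starts⁻ k-key k′-key b b′ least)
        (λ (k , k′ , b , b′ , c , opens) →
          (from (family⇔ B) (k , IsRooted.crossing-keyˡ isRooted c , b) ,
           from (family⇔ B′) (k′ , IsRooted.crossing-keyʳ isRooted c , b′) , crossing-blocks key b b′ c) ,
          starts b b′ opens)
    }
    where
    family⇔ : ∀ B → ColourClass H B ⇔ (∃[ k ] key k ≡ k × IsBlock key B k)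
    family⇔ B = mk⇔ (λ (v , c) → key v , IsRooted.key-idem isRooted v , to (class⇔block B v) c)
                    (λ (k , k-key , b) → k , from (class⇔block B k) (subst (IsBlock key B) (sym k-key) b))

-- From interval families back to hook configurations

module ToVHC {m} {w : ℕ → Value m} {Iv : ℕ → ℕ → Set} (I : Intervals w Iv) where
  open Intervals I

  private
    ≢top : ∀ (i : Fin m) → m ≢ toℕ (w (toℕ i))
    ≢top i eq = ℕ.<⇒≢ (Fin.toℕ<n i) (w-injective (ℕ.<⇒≤ (Fin.toℕ<n i)) ℕ.≤-refl
      (trans (Fin.toℕ-injective (trans (sym eq) (sym (Fin.toℕ-fromℕ m)))) (sym w-top)))

    position<m : ∀ (u : Fin m) → position (inject₁ u) < m
    position<m u = ℕ.≤∧≢⇒< (position≤ _) λ eq →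
      Fin.fromℕ≢inject₁ (trans (sym w-top) (trans (cong w (sym eq)) (w-position (inject₁ u))))

  π : Permutation′ m
  π = permutation (λ i → lower₁ (w (toℕ i)) (≢top i)) (λ u → fromℕ< (position<m u))
    (λ u → Fin.inject₁-injective (trans (Fin.inject₁-lower₁ _ _)
      (trans (cong w (Fin.toℕ-fromℕ< (position<m u))) (w-position (inject₁ u)))))
    (λ i → Fin.toℕ-injective (trans (Fin.toℕ-fromℕ< (position<m _))
      (trans (cong position (Fin.inject₁-lower₁ _ (≢top i))) (position-w (ℕ.<⇒≤ (Fin.toℕ<n i))))))

  private
    inject₁-π : ∀ i → inject₁ (π ⟨$⟩ʳ i) ≡ w (toℕ i)
    inject₁-π i = Fin.inject₁-lower₁ _ (≢top i)

    π-toℕ : ∀ i → toℕ (π ⟨$⟩ʳ i) ≡ toℕ (w (toℕ i))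
    π-toℕ i = Fin.toℕ-lower₁ _ (≢top i)

    π-< : ∀ {i j} → w (toℕ i) Fin.< w (toℕ j) → π ⟨$⟩ʳ i Fin.< π ⟨$⟩ʳ j
    π-< {i} {j} = subst₂ _<_ (sym (π-toℕ i)) (sym (π-toℕ j))

    endOf : Fin m → Fin m
    endOf d with last (suc (toℕ d)) <? m
    ... | yes j<m = fromℕ< j<m
    -- A default value; by `real-end` this case does not arise when an interval opens after `d`.
    ... | no _ = d

    real-end : ∀ {d j} → Iv (suc d) j → j < m
    real-end iv = laminar sky iv (s≤s z≤n) (ℕ.≤-trans (ordered iv) (bounded iv))

    endOf-interval : ∀ {d j} → Iv (suc (toℕ d)) j → toℕ (endOf d) ≡ j
    endOf-interval {d} iv with last (suc (toℕ d)) <? m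
    ... | yes j<m = trans (Fin.toℕ-fromℕ< j<m) (last-start iv)
    ... | no j≮m = contradiction (subst (_< m) (sym (last-start iv)) (real-end iv)) j≮m

    hookAt : Fin m → Hook m
    hookAt d = hook d (endOf d)

    hooks : List (Hook m)
    hooks = map hookAt (descents π)

    descent-interval : ∀ {d} → Descent π d → ∃[ j ] Iv (suc (toℕ d)) j
    descent-interval {d} (e , eq , lt) with ascent (Fin.toℕ<n d)
    ... | inj₁ iv = iv
    ... | inj₂ (_ , rise) = contradiction (subst₂ _<_ (π-toℕ e) (π-toℕ d) lt)
          (ℕ.<-asym (subst (λ e → w (toℕ d) Fin.< w e) (sym eq) rise))

    interval-descent : ∀ {d j} → Iv (suc (toℕ d)) j → Descent π d
    interval-descent {d} iv with e , eq ← real (ℕ.≤-<-trans (ordered iv) (real-end iv)) =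
      e , eq , π-< (subst (λ e → w e Fin.< w (toℕ d)) (sym eq) (descent iv))

    hook-interval : ∀ {h} → h List.∈ hooks → Iv (suc (toℕ (sw h))) (toℕ (ne h))
    hook-interval h∈ with d , d∈ , refl ← ∈-map⁻ hookAt h∈
      with j , iv ← descent-interval (proj₂ (∈-filter⁻ (descent? π) {xs = allFin m} d∈)) =
      subst (Iv _) (sym (endOf-interval iv)) iv

    interval-hook : ∀ {d j} → Iv (suc d) j → ∃[ h ] h List.∈ hooks × toℕ (sw h) ≡ d × toℕ (ne h) ≡ j
    interval-hook iv with d , refl ← real (ℕ.<⇒≤ (ℕ.≤-<-trans (ordered iv) (real-end iv))) =
      hookAt d , ∈-map⁺ hookAt (∈-filter⁺ (descent? π) (∈-allFin d) (interval-descent iv)) ,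
      refl , endOf-interval iv

    -- A common point lies on the horizontal part of `h`. If `sw h′` came before `ne h`, then `h′`
    -- would be nested and `peak` would keep it entirely below that part; so the two endpoints
    -- coincide.
    meet : ∀ {h h′} → h List.∈ hooks → h′ List.∈ hooks → sw h Fin.< sw h′ →
           ∀ x y → OnHook π h x y → OnHook π h′ x y → AtNE π h x y × AtSW π h′ x y
    meet {h} {h′} h∈ h′∈ d<d′ x y on on′ = at on on′
      where
      d′≤x : OnHook π h′ x y → sw h′ Fin.≤ x
      d′≤x (inj₁ (refl , _)) = ℕ.≤-refl
      d′≤x (inj₂ (d′≤x , _)) = d′≤x

      y≤ : OnHook π h′ x y → y Fin.≤ π ⟨$⟩ʳ ne h′
      y≤ (inj₁ (_ , _ , y≤)) = y≤
      y≤ (inj₂ (_ , _ , refl)) = ℕ.≤-refl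

      at : OnHook π h x y → OnHook π h′ x y → AtNE π h x y × AtSW π h′ x y
      at (inj₁ (refl , _)) on′ = contradiction d<d′ (ℕ.≤⇒≯ (d′≤x on′))
      at (inj₂ (_ , x≤j , refl)) on′ with ℕ.m≤n⇒m<n∨m≡n (ℕ.≤-trans (d′≤x on′) x≤j)
      ... | inj₂ d′≡j =
            (x≡j , refl) , trans x≡j (sym ends) , cong (π ⟨$⟩ʳ_) (sym ends)
        where
        ends = Fin.toℕ-injective d′≡j
        x≡j = Fin.≤-antisym x≤j (subst (Fin._≤ x) ends (d′≤x on′))
      ... | inj₁ d′<j = contradiction (y≤ on′) (ℕ.<⇒≱ (π-< (peak (hook-interval h∈)
              (ℕ.<-trans d<d′ (ordered (hook-interval h′∈)))
              (laminar (hook-interval h∈) (hook-interval h′∈) (s≤s d<d′) d′<j))))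

    sw-injective : ∀ {h h′} → h List.∈ hooks → h′ List.∈ hooks → sw h ≡ sw h′ → h ≡ h′
    sw-injective h∈ h′∈ eq with d , _ , refl ← ∈-map⁻ hookAt h∈ | d′ , _ , refl ← ∈-map⁻ hookAt h′∈ = cong hookAt eq

    isVHC : IsVHC π hooks
    isVHC = record
      { isHook = λ h∈ → ordered (hook-interval h∈) , π-< (above (hook-interval h∈))
      ; southwest = trans (sym (map-∘ (descents π))) (map-id (descents π))
      ; noPointAbove = λ h∈ l d<l l<j → π-< (peak (hook-interval h∈) d<l l<j)
      ; nonIntersecting = nonIntersecting
      }
      where
      nonIntersecting : ∀ {h h′} → h List.∈ hooks → h′ List.∈ hooks → h ≢ h′ → ∀ x y →
        OnHook π h x y → OnHook π h′ x y → (AtNE π h x y × AtSW π h′ x y) ⊎ (AtSW π h x y × AtNE π h′ x y)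
      nonIntersecting {h} {h′} h∈ h′∈ h≢h′ x y on on′ with Fin.<-cmp (sw h) (sw h′)
      ... | tri< d<d′ _ _ = inj₁ (meet h∈ h′∈ d<d′ x y on on′)
      ... | tri≈ _ eq _ = contradiction (sw-injective h∈ h′∈ eq) h≢h′
      ... | tri> _ _ d′<d = let ne′ , sw′ = meet h′∈ h∈ d′<d x y on′ on in inj₂ (sw′ , ne′)

  vhc : VHC m
  vhc = record { perm = π ; hooks = hooks ; isVHC = isVHC }

  vhc-word : ∀ {l} → l ≤ m → FromVHC.w vhc l ≡ w l
  vhc-word l≤m with ℕ.m≤n⇒m<n∨m≡n l≤m
  ... | inj₁ l<m with i , refl ← real l<m = trans (FromVHC.w-toℕ vhc i) (inject₁-π i)
  vhc-word l≤m | inj₂ refl = trans (FromVHC.w-m vhc) (sym w-top)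

  vhc-interval : ∀ {o j} → FromVHC.Interval vhc o j ⇔ Iv o j
  vhc-interval = mk⇔
    (λ { (FromVHC.sky refl refl) → sky ; (FromVHC.arc h∈ refl refl) → hook-interval h∈ })
    backward
    where
    backward : ∀ {o j} → Iv o j → FromVHC.Interval vhc o j
    backward {zero} iv = FromVHC.sky refl (unique iv sky)
    backward {suc d} iv with h , h∈ , eq , eq′ ← interval-hook iv = FromVHC.arc h∈ (cong suc (sym eq)) (sym eq′)

-- The bijection

⇔-sym : ∀ {A B : Set} → A ⇔ B → B ⇔ A
⇔-sym e = mk⇔ (from e) (to e)

Φ-isAcyclicConnected : ∀ {m} (H : VHC m) → IsAcyclicConnected (Φ H)
Φ-isAcyclicConnected H = isAcyclicConnected (FromVHC.isRooted H) (FromVHC.represents H)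

Φ̂ : ∀ {m} → VHC m → 𝒫ᶜ m
Φ̂ H = Φ H , Φ-isAcyclicConnected H

Φ-cong : ∀ {m} {H H′ : VHC m} → H ≈ᵛ H′ → Φ̂ H ≈ᵖ Φ̂ H′
Φ-cong {m} {H} {H′} (π≈ , hooks≡) =
  (λ B → mk⇔ (proj₁ forth B) (proj₁ back B)) , (λ B B′ → mk⇔ (proj₂ forth B B′) (proj₂ back B B′))
  where
  module F = FromVHC H
  module F′ = FromVHC H′

  w≡ : ∀ {l} → l ≤ m → F.w l ≡ F′.w l
  w≡ l≤m with ℕ.m≤n⇒m<n∨m≡n l≤m
  ... | inj₁ l<m with i , refl ← real l<m = trans (F.w-toℕ i) (trans (cong inject₁ (π≈ i)) (sym (F′.w-toℕ i)))
  w≡ l≤m | inj₂ refl = trans F.w-m (sym F′.w-m)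

  Iv⇔ : ∀ {o j} → F.Interval o j ⇔ F′.Interval o j
  Iv⇔ = mk⇔
    (λ { (FromVHC.sky p q) → FromVHC.sky p q ; (FromVHC.arc h∈ p q) → FromVHC.arc (subst (_ List.∈_) hooks≡ h∈) p q })
    (λ { (FromVHC.sky p q) → FromVHC.sky p q ; (FromVHC.arc h∈ p q) → FromVHC.arc (subst (_ List.∈_) (sym hooks≡) h∈) p q })

  forth = represents-⊆ F.represents F′.represents (same-key F.intervals F′.intervals w≡ Iv⇔)
            (same-arrow F.intervals F′.intervals w≡ Iv⇔)
  back = represents-⊆ F′.represents F.represents
           (same-key F′.intervals F.intervals (λ l≤m → sym (w≡ l≤m)) (⇔-sym Iv⇔))
           (same-arrow F′.intervals F.intervals (λ l≤m → sym (w≡ l≤m)) (⇔-sym Iv⇔))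

Φ-injective : ∀ {m} {H H′ : VHC m} → Φ̂ H ≈ᵖ Φ̂ H′ → H ≈ᵛ H′
Φ-injective {m} {H} {H′} (ρ⇔ , α⇔) = π≈ , map-injective-local sw same-sw same-hook
  where
  module F = FromVHC H
  module F′ = FromVHC H′
  module I = Intervals F.intervals
  module I′ = Intervals F′.intervals
  open VHC

  key≗ : I.key ≗ I′.key
  key≗ = represents-key F.represents F′.represents F.isRooted F′.isRooted (λ B → to (ρ⇔ B))

  arrow⇔ : ∀ k k′ → k I.⟶ k′ ⇔ k I′.⟶ k′
  arrow⇔ k k′ = mk⇔
    (represents-arrow F.represents F′.represents F.isRooted key≗ (λ B B′ → to (α⇔ B B′)))
    (represents-arrow F′.represents F.represents F′.isRooted (λ v → sym (key≗ v)) (λ B B′ → from (α⇔ B B′)))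

  w≡ : ∀ {l} → l ≤ m → F.w l ≡ F′.w l
  w≡ = greedy-unique key≗ arrow⇔ I.isGreedy I′.isGreedy

  π≈ : ∀ i → perm H ⟨$⟩ʳ i ≡ perm H′ ⟨$⟩ʳ i
  π≈ i = Fin.inject₁-injective
    (trans (sym (F.w-toℕ i)) (trans (w≡ (ℕ.<⇒≤ (Fin.toℕ<n i))) (F′.w-toℕ i)))

  same-sw : map sw (hooks H) ≡ map sw (hooks H′)
  same-sw = trans (IsVHC.southwest (isVHC H)) (trans
    (filter-≐ (descent? (perm H)) (descent? (perm H′))
      ((λ (j , eq , lt) → j , eq , subst₂ Fin._<_ (π≈ _) (π≈ _) lt) ,
       (λ (j , eq , lt) → j , eq , subst₂ Fin._<_ (sym (π≈ _)) (sym (π≈ _)) lt)) (allFin m))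
    (sym (IsVHC.southwest (isVHC H′))))

  -- The value at the right end of an interval is the key of the value at its start, and words and
  -- keys already agree.
  same-end : ∀ {o j j′} → F.Interval o j → F′.Interval o j′ → j ≡ j′
  same-end {o} iv iv′ = I′.w-injective (I.bounded iv) (I′.bounded iv′)
    (trans (sym (w≡ (I.bounded iv))) (trans (sym (I.key-start iv)) (trans (key≗ (F.w o))
      (trans (cong I′.key (w≡ (ℕ.≤-trans (I.ordered iv) (I.bounded iv)))) (I′.key-start iv′)))))

  same-hook : ∀ {h h′} → h List.∈ hooks H → h′ List.∈ hooks H′ → sw h ≡ sw h′ → h ≡ h′
  same-hook {h} {h′} h∈ h′∈ refl = cong (hook (sw h)) (Fin.toℕ-injective
    (same-end (FromVHC.arc h∈ refl refl) (FromVHC.arc h′∈ refl refl)))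

≈ᵖ-trans : ∀ {m} {x y z : 𝒫ᶜ m} → x ≈ᵖ y → y ≈ᵖ z → x ≈ᵖ z
≈ᵖ-trans (p , q) (p′ , q′) =
  (λ B → mk⇔ (to (p′ B) ∘ to (p B)) (from (p B) ∘ from (p′ B))) ,
  (λ B B′ → mk⇔ (to (q′ B B′) ∘ to (q B B′)) (from (q B B′) ∘ from (q′ B B′)))

-- The preimage is read off the greedy word of `y`: `FromWord` supplies the intervals and `ToVHC`
-- the hooks, and keys and arrows are preserved by both passages.
Φ-strictlySurjective : ∀ {m} (y : 𝒫ᶜ m) → ∃[ H ] Φ̂ H ≈ᵖ y
Φ-strictlySurjective {m} y@(ρα , isAC) = build (greedy-exists rooted)
  where
  rooted = keyOf-isRooted isAC

  build : ∃[ w ] IsGreedy (keyOf isAC) (arrowOf isAC) w m × w m ≡ fromℕ m → ∃[ H ] Φ̂ H ≈ᵖ y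
  build (w , greedy , top) = vhc ,
    (λ B → mk⇔ (proj₁ forth B) (proj₁ back B)) , (λ B B′ → mk⇔ (proj₂ forth B B′) (proj₂ back B B′))
    where
    open FromWord rooted greedy top
    open ToVHC intervals
    module F = FromVHC vhc

    key≗ : Intervals.key F.intervals ≗ keyOf isAC
    key≗ v = trans (same-key F.intervals intervals vhc-word vhc-interval v) (key-agrees v)

    forth = represents-⊆ F.represents (keyOf-represents isAC) key≗
      (λ {k} {k′} e → to (arrow-agrees k k′) (same-arrow F.intervals intervals vhc-word vhc-interval e))
    back = represents-⊆ (keyOf-represents isAC) F.represents (λ v → sym (key≗ v))
      (λ {k} {k′} e → same-arrow intervals F.intervals (λ l≤m → sym (vhc-word l≤m)) (⇔-sym vhc-interval)
                        (from (arrow-agrees k k′) e))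

theorem5p3 : (m : ℕ) →
    Σ[ Φ∈𝒫ᶜ ∈ ((H : VHC m) → IsAcyclicConnected (Φ H)) ]
    IsBijection _≈ᵛ_ _≈ᵖ_ (λ (H : VHC m) → Φ H , Φ∈𝒫ᶜ H)
theorem5p3 m = Φ-isAcyclicConnected , record
  { isInjection = record
    { isCongruent = record
      { cong = λ {H} {H′} → Φ-cong {m} {H} {H′}
      ; isEquivalence₁ = record
        { refl = (λ _ → refl) , refl
        ; sym = λ (p , q) → (λ i → sym (p i)) , sym q
        ; trans = λ (p , q) (p′ , q′) → (λ i → trans (p i) (p′ i)) , trans q q′
        }
      ; isEquivalence₂ = record
        { refl = (λ _ → mk⇔ id id) , (λ _ _ → mk⇔ id id)
        ; sym = λ (p , q) → (λ B → ⇔-sym (p B)) , (λ B B′ → ⇔-sym (q B B′))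
        ; trans = λ {x} {y} {z} → ≈ᵖ-trans {x = x} {y} {z}
        }
      }
    ; injective = λ {H} {H′} → Φ-injective {m} {H} {H′}
    }
  ; surjective = λ y → let H , ΦH≈y = Φ-strictlySurjective y in
      H , λ {H′} H′≈H → ≈ᵖ-trans {x = Φ̂ H′} {Φ̂ H} {y} (Φ-cong {H = H′} {H} H′≈H) ΦH≈y
  }
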